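{- Let $\Phi=(G,\varphi)$ be a complex unit gain graph with a pendant vertex $u$ whose unique neighbour is $v$, and let $F^{\varphi}=\Phi-u-v$ with underlying graph $F=G-u-v$. If $r(\Phi)=r(G)+2\theta(G)$ (respectively $r(\Phi)=r(G)-2\theta(G)$), then $v$ does not lie on any cycle of $G$, and $r(F^{\varphi})=r(F)+2\theta(F)$ (respectively $r(F^{\varphi})=r(F)-2\theta(F)$).
   Context: A complex unit gain graph $\Phi=(G,\varphi)$ consists of a finite simple graph $G$ with vertex set $\{v_1,\dots,v_n\}$ and a gain function $\varphi$ assigning to each oriented edge $e_{ij}$ ($v_iv_j\in E(G)$) a complex number of modulus $1$ with $\varphi(e_{ji})=\overline{\varphi(e_{ij})}$. $A(\Phi)$ is the Hermitian matrix with $(i,j)$ entry $\varphi(e_{ij})$ if $v_iv_j\in E(G)$ and $0$ otherwise; $r(\Phi)$ is its rank; $r(\cdot)$ of a simple graph is the rank of its $0$-$1$ adjacency matrix. Induced subgraphs of $\Phi$ (such as $\Phi-u-v$, obtained by deleting $u,v$ and incident edges) carry the gains of $\Phi$. $\theta(G)=|E(G)|-|V(G)|+\omega(G)$, $\omega(G)$ the number of components. A pendant vertex is a vertex of degree $1$. -}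

module Defs where

open import Level using (0ℓ)
open import Data.Bool.Base using (Bool; T)
open import Data.Bool.Properties using (T?)
open import Data.Empty using (⊥-elim)
open import Data.Fin.Base as Fin using (Fin; inject₁; fromℕ; punchIn; punchOut)
import Data.Fin.Properties as Fin
open import Data.Fin.Subset using (Subset; _∉_; ∣_∣; ⊥)
open import Data.Fin.Subset.Properties using (∣p∣≤n; ∣⊥∣≡0; ∉⊥)
open import Data.Integer.Base as ℤ using (ℤ; +_)
open import Data.List.Base using (List; []; _∷_; length; filter; allFin; cartesianProduct; deduplicate)
open import Data.List.Membership.Propositional using (_∈_)
open import Data.List.Membership.Propositional.Properties using (∈-allFin)
open import Data.List.Relation.Unary.Any using (here; there)
open import Data.Nat.Base as ℕ using (ℕ; zero; suc)
import Data.Nat.Properties as ℕ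
open import Data.Product using (Σ; ∃; _×_; _,_)
open import Data.Rational.Base as ℚ using (ℚ; 0ℚ; 1ℚ; ½)
import Data.Rational.Properties as ℚ
open import Data.Rational.Solver using (module +-*-Solver)
open import Data.Sum using (_⊎_; inj₁; inj₂)
open import Data.Vec.Functional using (foldr)
open import Function.Definitions using (Injective)
open import Relation.Binary.Core using (Rel)
open import Relation.Binary.Definitions using (Decidable)
open import Relation.Binary.Construct.Closure.ReflexiveTransitive using (Star; ε; _◅_; _◅◅_)
open import Relation.Binary.PropositionalEquality using (_≡_; _≢_; refl; sym; trans; cong; subst)
open import Relation.Nullary using (¬_; yes; no)
open import Relation.Nullary.Decidable using (_×-dec_; _⊎-dec_; map′)

-- ℝ is the setoid of Cauchy sequences of rationals modulo null sequences.
IsCauchy : (ℕ → ℚ) → Set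
IsCauchy x = ∀ δ → 0ℚ ℚ.< δ →
  ∃ λ N → ∀ m n → N ℕ.≤ m → N ℕ.≤ n → ℚ.∣ x m ℚ.- x n ∣ ℚ.< δ

record ℝ : Set where
  constructor mkℝ
  field
    seq    : ℕ → ℚ
    cauchy : IsCauchy seq
open ℝ public

infix 4 _≈ℝ_
_≈ℝ_ : ℝ → ℝ → Set
x ≈ℝ y = ∀ δ → 0ℚ ℚ.< δ →
  ∃ λ N → ∀ n → N ℕ.≤ n → ℚ.∣ seq x n ℚ.- seq y n ∣ ℚ.< δ

-- Abstract, since normalising these proofs is expensive.
abstract
  halves : ∀ q → ½ ℚ.* q ℚ.+ ½ ℚ.* q ≡ q
  halves = solve 1 (λ q → con ½ :* q :+ con ½ :* q := q) refl
    where open +-*-Solver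

  half-pos : ∀ {q} → 0ℚ ℚ.< q → 0ℚ ℚ.< ½ ℚ.* q
  half-pos {q} 0<q =
    subst (ℚ._< ½ ℚ.* q) (ℚ.*-zeroʳ ½) (ℚ.*-monoʳ-<-pos ½ 0<q)

  const-cauchy : ∀ q → IsCauchy (λ _ → q)
  const-cauchy q δ 0<δ = 0 , λ _ _ _ _ →
    subst (ℚ._< δ) (sym (cong ℚ.∣_∣ (ℚ.+-inverseʳ q))) 0<δ

  +-cauchy : ∀ {x y} → IsCauchy x → IsCauchy y → IsCauchy (λ n → x n ℚ.+ y n)
  +-cauchy {x} {y} cx cy δ 0<δ =
    let (M , p) = cx (½ ℚ.* δ) (half-pos 0<δ)
        (N , q) = cy (½ ℚ.* δ) (half-pos 0<δ)
    in M ℕ.⊔ N , λ m n h k → begin-strict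
      ℚ.∣ (x m ℚ.+ y m) ℚ.- (x n ℚ.+ y n) ∣
        ≡⟨ cong ℚ.∣_∣ (rearrange (x m) (y m) (x n) (y n)) ⟩
      ℚ.∣ (x m ℚ.- x n) ℚ.+ (y m ℚ.- y n) ∣
        ≤⟨ ℚ.∣p+q∣≤∣p∣+∣q∣ (x m ℚ.- x n) (y m ℚ.- y n) ⟩
      ℚ.∣ x m ℚ.- x n ∣ ℚ.+ ℚ.∣ y m ℚ.- y n ∣
        <⟨ ℚ.+-mono-< (p m n (ℕ.m⊔n≤o⇒m≤o M N h) (ℕ.m⊔n≤o⇒m≤o M N k))
                      (q m n (ℕ.m⊔n≤o⇒n≤o M N h) (ℕ.m⊔n≤o⇒n≤o M N k)) ⟩
      ½ ℚ.* δ ℚ.+ ½ ℚ.* δ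
        ≡⟨ halves δ ⟩
      δ ∎
    where
    open ℚ.≤-Reasoning
    rearrange : ∀ a b c d → (a ℚ.+ b) ℚ.- (c ℚ.+ d) ≡ (a ℚ.- c) ℚ.+ (b ℚ.- d)
    rearrange = solve 4 (λ a b c d → (a :+ b) :- (c :+ d) := (a :- c) :+ (b :- d)) refl
      where open +-*-Solver

  neg-cauchy : ∀ {x} → IsCauchy x → IsCauchy (λ n → ℚ.- x n)
  neg-cauchy {x} cx δ 0<δ =
    let (N , p) = cx δ 0<δ
    in N , λ m n h k → subst (ℚ._< δ)
         (trans (sym (ℚ.∣-p∣≡∣p∣ (x m ℚ.- x n)))
                (cong ℚ.∣_∣ (ℚ.neg-distrib-+ (x m) (ℚ.- x n))))
         (p m n h k)

  eventually-bounded : ∀ {x} → IsCauchy x →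
    ∃ λ B → 0ℚ ℚ.< B × ∃ λ N → ∀ n → N ℕ.≤ n → ℚ.∣ x n ∣ ℚ.≤ B
  eventually-bounded {x} cx =
    let (N , p) = cx 1ℚ (ℚ.positive⁻¹ 1ℚ)
    in 1ℚ ℚ.+ ℚ.∣ x N ∣
     , ℚ.+-mono-<-≤ (ℚ.positive⁻¹ 1ℚ) (ℚ.0≤∣p∣ (x N))
     , N , λ n h → begin
         ℚ.∣ x n ∣                             ≡⟨ cong ℚ.∣_∣ (split (x n) (x N)) ⟩
         ℚ.∣ (x n ℚ.- x N) ℚ.+ x N ∣           ≤⟨ ℚ.∣p+q∣≤∣p∣+∣q∣ (x n ℚ.- x N) (x N) ⟩
         ℚ.∣ x n ℚ.- x N ∣ ℚ.+ ℚ.∣ x N ∣       ≤⟨ ℚ.+-monoˡ-≤ ℚ.∣ x N ∣ (ℚ.<⇒≤ (p n N h ℕ.≤-refl)) ⟩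
         1ℚ ℚ.+ ℚ.∣ x N ∣                      ∎
    where
    open ℚ.≤-Reasoning
    split : ∀ a b → a ≡ (a ℚ.- b) ℚ.+ b
    split = solve 2 (λ a b → a := (a :- b) :+ b) refl
      where open +-*-Solver

  scale : ∀ {D δ} a b → 0ℚ ℚ.< D → ℚ.∣ a ∣ ℚ.≤ D → ℚ.∣ b ∣ ℚ.< δ →
          ℚ.∣ a ℚ.* b ∣ ℚ.< D ℚ.* δ
  scale {D} {δ} a b 0<D a≤D b<δ = begin-strict
    ℚ.∣ a ℚ.* b ∣          ≡⟨ ℚ.∣p*q∣≡∣p∣*∣q∣ a b ⟩
    ℚ.∣ a ∣ ℚ.* ℚ.∣ b ∣    ≤⟨ ℚ.*-monoʳ-≤-nonNeg ℚ.∣ b ∣ {{ℚ.∣-∣-nonNeg b}} a≤D ⟩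
    D ℚ.* ℚ.∣ b ∣          <⟨ ℚ.*-monoʳ-<-pos D {{ℚ.positive 0<D}} b<δ ⟩
    D ℚ.* δ                ∎
    where open ℚ.≤-Reasoning

  divide : ∀ {D q} → 0ℚ ℚ.< D → 0ℚ ℚ.< q → ∃ λ δ → 0ℚ ℚ.< δ × D ℚ.* δ ≡ q
  divide {D} {q} 0<D 0<q = ℚ.1/ D ℚ.* q
    , ℚ.positive⁻¹ _ {{ℚ.pos*pos⇒pos (ℚ.1/ D) {{ℚ.1/pos⇒pos D}} q}}
    , trans (sym (ℚ.*-assoc D (ℚ.1/ D) q))
        (trans (cong (ℚ._* q) (ℚ.*-inverseʳ D)) (ℚ.*-identityˡ q))
    where
    instance
      D-pos : ℚ.Positive D
      D-pos = ℚ.positive 0<D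
      q-pos : ℚ.Positive q
      q-pos = ℚ.positive 0<q
      D-nonZero : ℚ.NonZero D
      D-nonZero = ℚ.pos⇒nonZero D

  *-cauchy : ∀ {x y} → IsCauchy x → IsCauchy y → IsCauchy (λ n → x n ℚ.* y n)
  *-cauchy {x} {y} cx cy δ 0<δ =
    let (B , 0<B , K , b) = eventually-bounded cx
        (C , 0<C , L , c) = eventually-bounded cy
        (β , 0<β , Bβ)    = divide 0<B (half-pos 0<δ)
        (γ , 0<γ , Cγ)    = divide 0<C (half-pos 0<δ)
        (M , p)           = cx γ 0<γ
        (N , q)           = cy β 0<β
    in (K ℕ.⊔ L) ℕ.⊔ (M ℕ.⊔ N) , λ m n h k → begin-strict
      ℚ.∣ x m ℚ.* y m ℚ.- x n ℚ.* y n ∣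
        ≡⟨ cong ℚ.∣_∣ (rearrange (x m) (y m) (x n) (y n)) ⟩
      ℚ.∣ x m ℚ.* (y m ℚ.- y n) ℚ.+ y n ℚ.* (x m ℚ.- x n) ∣
        ≤⟨ ℚ.∣p+q∣≤∣p∣+∣q∣ (x m ℚ.* (y m ℚ.- y n)) (y n ℚ.* (x m ℚ.- x n)) ⟩
      ℚ.∣ x m ℚ.* (y m ℚ.- y n) ∣ ℚ.+ ℚ.∣ y n ℚ.* (x m ℚ.- x n) ∣
        <⟨ ℚ.+-mono-< (scale (x m) (y m ℚ.- y n) 0<B (b m (ll K L M N h)) (q m n (rr K L M N h) (rr K L M N k)))
                      (scale (y n) (x m ℚ.- x n) 0<C (c n (lr K L M N k)) (p m n (rl K L M N h) (rl K L M N k))) ⟩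
      B ℚ.* β ℚ.+ C ℚ.* γ
        ≡⟨ trans (cong (ℚ._+ C ℚ.* γ) Bβ) (cong (½ ℚ.* δ ℚ.+_) Cγ) ⟩
      ½ ℚ.* δ ℚ.+ ½ ℚ.* δ
        ≡⟨ halves δ ⟩
      δ ∎
    where
    open ℚ.≤-Reasoning
    module _ (K L M N : ℕ) {o : ℕ} (h : (K ℕ.⊔ L) ℕ.⊔ (M ℕ.⊔ N) ℕ.≤ o) where
      ll : K ℕ.≤ o
      ll = ℕ.m⊔n≤o⇒m≤o K L (ℕ.m⊔n≤o⇒m≤o (K ℕ.⊔ L) (M ℕ.⊔ N) h)
      lr : L ℕ.≤ o
      lr = ℕ.m⊔n≤o⇒n≤o K L (ℕ.m⊔n≤o⇒m≤o (K ℕ.⊔ L) (M ℕ.⊔ N) h)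
      rl : M ℕ.≤ o
      rl = ℕ.m⊔n≤o⇒m≤o M N (ℕ.m⊔n≤o⇒n≤o (K ℕ.⊔ L) (M ℕ.⊔ N) h)
      rr : N ℕ.≤ o
      rr = ℕ.m⊔n≤o⇒n≤o M N (ℕ.m⊔n≤o⇒n≤o (K ℕ.⊔ L) (M ℕ.⊔ N) h)
    rearrange : ∀ a b c d → a ℚ.* b ℚ.- c ℚ.* d ≡ a ℚ.* (b ℚ.- d) ℚ.+ d ℚ.* (a ℚ.- c)
    rearrange = solve 4 (λ a b c d → a :* b :- c :* d := a :* (b :- d) :+ d :* (a :- c)) refl
      where open +-*-Solver

fromℚ : ℚ → ℝ
fromℚ q = mkℝ (λ _ → q) (const-cauchy q)

0ℝ 1ℝ : ℝ
0ℝ = fromℚ 0ℚ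
1ℝ = fromℚ 1ℚ

infixl 6 _+ℝ_
infixl 7 _*ℝ_
infix  8 -ℝ_

_+ℝ_ : ℝ → ℝ → ℝ
x +ℝ y = mkℝ (λ n → seq x n ℚ.+ seq y n) (+-cauchy {seq x} {seq y} (cauchy x) (cauchy y))

-ℝ_ : ℝ → ℝ
-ℝ x = mkℝ (λ n → ℚ.- seq x n) (neg-cauchy {seq x} (cauchy x))

_*ℝ_ : ℝ → ℝ → ℝ
x *ℝ y = mkℝ (λ n → seq x n ℚ.* seq y n) (*-cauchy {seq x} {seq y} (cauchy x) (cauchy y))

record ℂ : Set where
  constructor _+i_
  field
    re : ℝ
    im : ℝ
open ℂ public

infix 4 _≈_
_≈_ : ℂ → ℂ → Set
z ≈ w = re z ≈ℝ re w × im z ≈ℝ im w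

0ℂ 1ℂ : ℂ
0ℂ = 0ℝ +i 0ℝ
1ℂ = 1ℝ +i 0ℝ

infixl 6 _+ℂ_
infixl 7 _*ℂ_

_+ℂ_ : ℂ → ℂ → ℂ
z +ℂ w = (re z +ℝ re w) +i (im z +ℝ im w)

_*ℂ_ : ℂ → ℂ → ℂ
z *ℂ w = ((re z *ℝ re w) +ℝ (-ℝ (im z *ℝ im w))) +i ((re z *ℝ im w) +ℝ (im z *ℝ re w))

conj : ℂ → ℂ
conj z = re z +i (-ℝ im z)

-- |z| = √(re² + im²) equals 1 exactly when the radicand does.
HasUnitModulus : ℂ → Set
HasUnitModulus z = (re z *ℝ re z) +ℝ (im z *ℝ im z) ≈ℝ 1ℝ

Matrix : ℕ → ℕ → Set
Matrix m n = Fin m → Fin n → ℂ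

∑ : ∀ {n} → (Fin n → ℂ) → ℂ
∑ = foldr _+ℂ_ 0ℂ

ColumnsIndependent : ∀ {m n} → Matrix m n → Subset n → Set
ColumnsIndependent {m} {n} A S =
  (c : Fin n → ℂ) → (∀ j → j ∉ S → c j ≈ 0ℂ) →
  (∀ i → ∑ (λ j → c j *ℂ A i j) ≈ 0ℂ) → ∀ j → c j ≈ 0ℂ

-- The rank is the maximal number of linearly independent columns.  Since
-- equality in ℂ is undecidable it is given by its graph: rank-unique and
-- rank-exists say that it is functional and (classically) total.
IsRank : ∀ {m n} → Matrix m n → ℕ → Set
IsRank {n = n} A r =
  (Σ (Subset n) λ S → ColumnsIndependent A S × ∣ S ∣ ≡ r) ×
  (∀ S → ColumnsIndependent A S → ∣ S ∣ ℕ.≤ r)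

rank-unique : ∀ {m n} (A : Matrix m n) {r s} → IsRank A r → IsRank A s → r ≡ s
rank-unique A ((S , indS , refl) , maxS) ((T , indT , refl) , maxT) =
  ℕ.≤-antisym (maxT S indS) (maxS T indT)

rank-exists : ∀ {m n} (A : Matrix m n) → ¬ ¬ ∃ (IsRank A)
rank-exists {n = n} A = search n (λ S _ → ∣p∣≤n S)
  where
  search : ∀ d → (∀ S → ColumnsIndependent A S → ∣ S ∣ ℕ.≤ d) → ¬ ¬ ∃ (IsRank A)
  search zero bound none =
    none (0 , (⊥ , (λ c c≈0 _ j → c≈0 j ∉⊥) , ∣⊥∣≡0 n) , bound)
  search (suc d) bound none = search d smaller none
    where
    smaller : ∀ S → ColumnsIndependent A S → ∣ S ∣ ℕ.≤ d
    smaller S ind with ∣ S ∣ ℕ.≟ suc d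
    ... | yes eq = ⊥-elim (none (suc d , (S , ind , eq) , bound))
    ... | no neq = ℕ.≤-pred (ℕ.≤∧≢⇒< (bound S ind) neq)

record Graph (n : ℕ) : Set where
  field
    adj    : Fin n → Fin n → Bool
    symm   : ∀ {i j} → T (adj i j) → T (adj j i)
    irrefl : ∀ {i} → ¬ T (adj i i)

  Adj : Rel (Fin n) 0ℓ
  Adj i j = T (adj i j)

  adj? : Decidable Adj
  adj? i j = T? (adj i j)

  adj⇒≢ : ∀ {i j} → Adj i j → i ≢ j
  adj⇒≢ e refl = irrefl e

  Connected : Rel (Fin n) 0ℓ
  Connected = Star Adj

  private
    -- Warshall: walks whose interior vertices all belong to a given list.
    Via : List (Fin n) → Rel (Fin n) 0ℓ
    Via []       i j = i ≡ j ⊎ Adj i j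
    Via (k ∷ ks) i j = Via ks i j ⊎ (Via ks i k × Via ks k j)

    via? : ∀ ks → Decidable (Via ks)
    via? []       i j = (i Fin.≟ j) ⊎-dec adj? i j
    via? (k ∷ ks) i j = via? ks i j ⊎-dec (via? ks i k ×-dec via? ks k j)

    via-sound : ∀ ks {i j} → Via ks i j → Connected i j
    via-sound []       (inj₁ refl)    = ε
    via-sound []       (inj₂ e)       = e ◅ ε
    via-sound (k ∷ ks) (inj₁ p)       = via-sound ks p
    via-sound (k ∷ ks) (inj₂ (p , q)) = via-sound ks p ◅◅ via-sound ks q

    via-base : ∀ ks {i j} → i ≡ j ⊎ Adj i j → Via ks i j
    via-base []       p = p
    via-base (k ∷ ks) p = inj₁ (via-base ks p)

    via-to : ∀ {ks i k} → Via (k ∷ ks) i k → Via ks i k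
    via-to (inj₁ p)       = p
    via-to (inj₂ (p , _)) = p

    via-from : ∀ {ks k j} → Via (k ∷ ks) k j → Via ks k j
    via-from (inj₁ p)       = p
    via-from (inj₂ (_ , p)) = p

    via-trans : ∀ {ks i l j} → l ∈ ks → Via ks i l → Via ks l j → Via ks i j
    via-trans {_ ∷ ks} (here refl) p              q              = inj₂ (via-to {ks} p , via-from {ks} q)
    via-trans (there l∈) (inj₁ p)       (inj₁ q)       = inj₁ (via-trans l∈ p q)
    via-trans (there l∈) (inj₁ p)       (inj₂ (q , r)) = inj₂ (via-trans l∈ p q , r)
    via-trans (there l∈) (inj₂ (p , q)) (inj₁ r)       = inj₂ (p , via-trans l∈ q r)
    via-trans (there l∈) (inj₂ (p , _)) (inj₂ (_ , r)) = inj₂ (p , r)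

    via-complete : ∀ {i j} → Connected i j → Via (allFin n) i j
    via-complete ε               = via-base (allFin n) (inj₁ refl)
    via-complete (_◅_ {j = k} e w) =
      via-trans (∈-allFin k) (via-base (allFin n) (inj₂ e)) (via-complete w)

  connected? : Decidable Connected
  connected? i j = map′ (via-sound (allFin n)) via-complete (via? (allFin n) i j)

  edgeCount : ℕ
  edgeCount = length (filter (λ (i , j) → (i Fin.<? j) ×-dec adj? i j)
                             (cartesianProduct (allFin n) (allFin n)))

  -- One representative is kept from each class of Connected.
  componentCount : ℕ
  componentCount = length (deduplicate connected? (allFin n))

  θ : ℤ
  θ = + edgeCount ℤ.- + n ℤ.+ + componentCount

  degree : Fin n → ℕ
  degree i = length (filter (adj? i) (allFin n))

  Pendant : Fin n → Set
  Pendant i = degree i ≡ 1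

  record Cycle : Set where
    field
      {k}      : ℕ
      vertex   : Fin (3 ℕ.+ k) → Fin n
      distinct : Injective _≡_ _≡_ vertex
      step     : ∀ i → Adj (vertex (inject₁ i)) (vertex (Fin.suc i))
      close    : Adj (vertex (fromℕ (2 ℕ.+ k))) (vertex Fin.zero)

  LiesOn : Fin n → Cycle → Set
  LiesOn v C = ∃ λ i → Cycle.vertex C i ≡ v

  adjacencyMatrix : Matrix n n
  adjacencyMatrix i j with adj? i j
  ... | yes _ = 1ℂ
  ... | no  _ = 0ℂ

record GainGraph (n : ℕ) : Set where
  field
    graph : Graph n
  open Graph graph public using (Adj; adj?; symm)
  field
    gain      : ∀ i j → Adj i j → ℂ
    unit      : ∀ i j (e : Adj i j) → HasUnitModulus (gain i j e)
    hermitian : ∀ i j (e : Adj i j) → gain j i (symm e) ≈ conj (gain i j e)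

  gainMatrix : Matrix n n
  gainMatrix i j with adj? i j
  ... | yes e = gain i j e
  ... | no  _ = 0ℂ

-- The vertices that remain are renumbered by punchIn, in the same order.
deleteᴳ : ∀ {n} → Graph (suc n) → Fin (suc n) → Graph n
deleteᴳ G u = record
  { adj    = λ i j → Graph.adj G (punchIn u i) (punchIn u j)
  ; symm   = Graph.symm G
  ; irrefl = Graph.irrefl G
  }

delete : ∀ {n} → GainGraph (suc n) → Fin (suc n) → GainGraph n
delete Φ u = record
  { graph     = deleteᴳ (GainGraph.graph Φ) u
  ; gain      = λ i j → GainGraph.gain Φ (punchIn u i) (punchIn u j)
  ; unit      = λ i j → GainGraph.unit Φ (punchIn u i) (punchIn u j)
  ; hermitian = λ i j → GainGraph.hermitian Φ (punchIn u i) (punchIn u j)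
  }

deletePairᴳ : ∀ {n} → Graph (suc (suc n)) → (u v : Fin (suc (suc n))) → u ≢ v → Graph n
deletePairᴳ G u v u≢v = deleteᴳ (deleteᴳ G u) (punchOut u≢v)

deletePair : ∀ {n} → GainGraph (suc (suc n)) → (u v : Fin (suc (suc n))) → u ≢ v → GainGraph n
deletePair Φ u v u≢v = delete (delete Φ u) (punchOut u≢v)

{-# OPTIONS --safe #-}
-- Write θ for the cyclomatic number.  If A and B are matrices whose nonzero entries are exactly the edges of
-- the same graph G, then rank A ≤ rank B + 2 θ(G).  This follows by induction on G: an isolated vertex can
-- be deleted without changing the ranks; a pendant vertex together with its neighbour can be deleted, which
-- lowers both ranks by exactly 2; and otherwise every degree is at least 2, so a maximal path shows that
-- some vertex x has two neighbours connected in G - x, and deleting x lowers θ by at least 1 and each rank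
-- by at most 2.
-- In the theorem r(Φ) - r(Fᵠ) = 2 = r(G) - r(F), hence r(Fᵠ) - r(F) = ± 2 θ(G), and the bound for F yields
-- θ(G) ≤ θ(F).  Since deleting vertices never increases θ, and strictly decreases it when a deleted vertex is
-- on a cycle, θ(F) = θ(G) and v is on no cycle.
-- Independence over ℂ is undecidable, but all conclusions are stable under double negation, so the rank
-- inequalities are stated in double-negated form.
module Submission where

open import Defs
open import Algebra.Bundles using (CommutativeRing)
open import Data.Bool.Base using (true; false)
open import Data.Fin.Base as Fin using (Fin; zero; suc; inject₁; fromℕ; toℕ; punchIn; punchOut)
import Data.Fin.Properties as Fin
open import Data.Fin.Relation.Unary.Top using (view; ‵fromℕ; ‵inject₁)
open import Data.Fin.Subset using (Subset; Side; inside; outside; _∈_; _∉_; ∣_∣)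
open import Data.Integer.Base as ℤ using (ℤ; +_; _+_; _-_; _*_)
import Data.Integer.Properties as ℤ
import Data.Integer.Solver as ℤ
open import Data.List.Base
  using (List; []; _∷_; _++_; length; lookup; map; filter; allFin; cartesianProduct; deduplicate)
import Data.List.Membership.DecPropositional as DecMembership
open import Data.List.Membership.Propositional using (find; lose) renaming (_∈_ to _∈ˡ_)
open import Data.List.Membership.Propositional.Properties
  using (∈-allFin; ∈-lookup; ∈-map⁻; ∈-++⁻; ∈-filter⁺; ∈-filter⁻; ∈-cartesianProduct⁺)
import Data.List.Properties as List
open import Data.List.Relation.Unary.All as All using (All; []; _∷_)
import Data.List.Relation.Unary.All.Properties as All
open import Data.List.Relation.Unary.AllPairs using (AllPairs; []; _∷_)
open import Data.List.Relation.Unary.Any as Any using (Any; here; there)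
import Data.List.Relation.Unary.Any.Properties as Any
open import Data.List.Relation.Unary.Linked using (Linked; [-]; _∷_)
import Data.List.Relation.Unary.Unique.DecSetoid.Properties as Unique using (deduplicate-!)
open import Data.List.Relation.Unary.Unique.Propositional using (Unique)
import Data.List.Relation.Unary.Unique.Propositional.Properties as Unique
open import Data.Nat.Base as ℕ using (ℕ; zero; suc)
open import Data.Nat.Induction using (<-rec)
import Data.Nat.Properties as ℕ
import Data.Nat.Solver as ℕ
open import Data.Product using (∃; ∃₂; _×_; _,_; proj₁; proj₂)
open import Data.Rational.Base as ℚ using (ℚ; 0ℚ; 1ℚ; ½)
import Data.Rational.Properties as ℚ
import Data.Rational.Solver as ℚ
open import Data.Sum using (_⊎_; inj₁; inj₂)
open import Data.Vec.Base using ([]; _∷_; insertAt; removeAt) renaming (lookup to lookupᵛ)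
import Data.Vec.Functional as Vector
import Data.Vec.Functional.Properties as Vector
import Data.Vec.Properties as Vec
open import Function.Base using (_∘_)
open import Level using (0ℓ)
open import Relation.Binary.Bundles using (DecSetoid)
open import Relation.Binary.Construct.Closure.ReflexiveTransitive using (ε; _◅_; _◅◅_; reverse)
open import Relation.Binary.Core using (Rel)
open import Relation.Binary.Definitions using (tri<; tri≈; tri>)
open import Relation.Binary.PropositionalEquality as ≡ using (_≡_; _≢_; refl; cong; cong₂; subst; subst₂)
open import Relation.Nullary using (¬_; yes; no)
open import Relation.Nullary.Decidable using (¬?; _×-dec_; _→-dec_; decidable-stable)
open import Relation.Nullary.Negation using (contradiction)

open Graph
open GainGraph using (graph; gainMatrix)

-- Cauchy reals and ℂ as an integral domain with stable equality

module _ where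

  open ℚ.+-*-Solver

  abstract

    -[a-b]≡b-a : ∀ a b →
      ℚ.- (a ℚ.- b) ≡ b ℚ.- a
    -[a-b]≡b-a = solve 2 (λ a b →
      :- (a :- b) := b :- a) refl

    a-b+b-c≡a-c : ∀ a b c →
      (a ℚ.- b) ℚ.+ (b ℚ.- c) ≡ a ℚ.- c
    a-b+b-c≡a-c = solve 3 (λ a b c →
      (a :- b) :+ (b :- c) := a :- c) refl

    +-sub : ∀ a b c d →
      (a ℚ.- b) ℚ.+ (c ℚ.- d) ≡ (a ℚ.+ c) ℚ.- (b ℚ.+ d)
    +-sub = solve 4 (λ a b c d →
      (a :- b) :+ (c :- d) := (a :+ c) :- (b :+ d)) refl

    -‿sub : ∀ a b →
      ℚ.- (a ℚ.- b) ≡ ℚ.- a ℚ.- ℚ.- b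
    -‿sub = solve 2 (λ a b →
      :- (a :- b) := :- a :- :- b) refl

    -- A difference of products split so that each summand is one of the sequences times a
    -- difference, the shape that `cauchy*null` accepts.
    *-sub : ∀ a b c d →
      a ℚ.* (c ℚ.- d) ℚ.+ d ℚ.* (a ℚ.- b) ≡ a ℚ.* c ℚ.- b ℚ.* d
    *-sub = solve 4 (λ a b c d →
      a :* (c :- d) :+ d :* (a :- b) := a :* c :- b :* d) refl

    re-*-comm : ∀ a b c d →
      a ℚ.* c ℚ.+ ℚ.- (b ℚ.* d) ≡ c ℚ.* a ℚ.+ ℚ.- (d ℚ.* b)
    re-*-comm = solve 4 (λ a b c d →
      a :* c :+ :- (b :* d) := c :* a :+ :- (d :* b)) refl

    im-*-comm : ∀ a b c d →
      a ℚ.* d ℚ.+ b ℚ.* c ≡ c ℚ.* b ℚ.+ d ℚ.* a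
    im-*-comm = solve 4 (λ a b c d →
      a :* d :+ b :* c := c :* b :+ d :* a) refl

    re-*-assoc : ∀ a b c d e f →
      (a ℚ.* c ℚ.+ ℚ.- (b ℚ.* d)) ℚ.* e ℚ.+ ℚ.- ((a ℚ.* d ℚ.+ b ℚ.* c) ℚ.* f) ≡
      a ℚ.* (c ℚ.* e ℚ.+ ℚ.- (d ℚ.* f)) ℚ.+ ℚ.- (b ℚ.* (c ℚ.* f ℚ.+ d ℚ.* e))
    re-*-assoc = solve 6 (λ a b c d e f →
      (a :* c :+ :- (b :* d)) :* e :+ :- ((a :* d :+ b :* c) :* f) :=
      a :* (c :* e :+ :- (d :* f)) :+ :- (b :* (c :* f :+ d :* e))) refl

    im-*-assoc : ∀ a b c d e f →
      (a ℚ.* c ℚ.+ ℚ.- (b ℚ.* d)) ℚ.* f ℚ.+ (a ℚ.* d ℚ.+ b ℚ.* c) ℚ.* e ≡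
      a ℚ.* (c ℚ.* f ℚ.+ d ℚ.* e) ℚ.+ b ℚ.* (c ℚ.* e ℚ.+ ℚ.- (d ℚ.* f))
    im-*-assoc = solve 6 (λ a b c d e f →
      (a :* c :+ :- (b :* d)) :* f :+ (a :* d :+ b :* c) :* e :=
      a :* (c :* f :+ d :* e) :+ b :* (c :* e :+ :- (d :* f))) refl

    re-*-identityˡ : ∀ a b →
      1ℚ ℚ.* a ℚ.+ ℚ.- (0ℚ ℚ.* b) ≡ a
    re-*-identityˡ = solve 2 (λ a b →
      con 1ℚ :* a :+ :- (con 0ℚ :* b) := a) refl

    im-*-identityˡ : ∀ a b →
      1ℚ ℚ.* b ℚ.+ 0ℚ ℚ.* a ≡ b
    im-*-identityˡ = solve 2 (λ a b →
      con 1ℚ :* b :+ con 0ℚ :* a := b) refl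

    re-distribˡ : ∀ a b c d e f →
      a ℚ.* (c ℚ.+ e) ℚ.+ ℚ.- (b ℚ.* (d ℚ.+ f)) ≡ (a ℚ.* c ℚ.+ ℚ.- (b ℚ.* d)) ℚ.+ (a ℚ.* e ℚ.+ ℚ.- (b ℚ.* f))
    re-distribˡ = solve 6 (λ a b c d e f →
      a :* (c :+ e) :+ :- (b :* (d :+ f)) := (a :* c :+ :- (b :* d)) :+ (a :* e :+ :- (b :* f))) refl

    im-distribˡ : ∀ a b c d e f →
      a ℚ.* (d ℚ.+ f) ℚ.+ b ℚ.* (c ℚ.+ e) ≡ (a ℚ.* d ℚ.+ b ℚ.* c) ℚ.+ (a ℚ.* f ℚ.+ b ℚ.* e)
    im-distribˡ = solve 6 (λ a b c d e f →
      a :* (d :+ f) :+ b :* (c :+ e) := (a :* d :+ b :* c) :+ (a :* f :+ b :* e)) refl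

    -- Real part of conj z (z w) = |z|² w for z = a + b i and w = c + d i; `im-norm-*` is the
    -- imaginary part.
    re-norm-* : ∀ a b c d →
      a ℚ.* (a ℚ.* c ℚ.+ ℚ.- (b ℚ.* d)) ℚ.+ b ℚ.* (a ℚ.* d ℚ.+ b ℚ.* c) ≡ (a ℚ.* a ℚ.+ b ℚ.* b) ℚ.* c
    re-norm-* = solve 4 (λ a b c d →
      a :* (a :* c :+ :- (b :* d)) :+ b :* (a :* d :+ b :* c) := (a :* a :+ b :* b) :* c) refl

    im-norm-* : ∀ a b c d →
      a ℚ.* (a ℚ.* d ℚ.+ b ℚ.* c) ℚ.+ ℚ.- (b ℚ.* (a ℚ.* c ℚ.+ ℚ.- (b ℚ.* d))) ≡ (a ℚ.* a ℚ.+ b ℚ.* b) ℚ.* d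
    im-norm-* = solve 4 (λ a b c d →
      a :* (a :* d :+ b :* c) :+ :- (b :* (a :* c :+ :- (b :* d))) := (a :* a :+ b :* b) :* d) refl

    norm-comm : ∀ a b →
      (a ℚ.* a ℚ.+ b ℚ.* b) ℚ.- 0ℚ ≡ (b ℚ.* b ℚ.+ a ℚ.* a) ℚ.- 0ℚ
    norm-comm = solve 2 (λ a b →
      (a :* a :+ b :* b) :- con 0ℚ := (b :* b :+ a :* a) :- con 0ℚ) refl

    a≡a-b+b : ∀ a b → a ≡ (a ℚ.- b) ℚ.+ b
    a≡a-b+b = solve 2 (λ a b → a := (a :- b) :+ b) refl

    -a*-a≡a*a : ∀ a → ℚ.- a ℚ.* ℚ.- a ≡ a ℚ.* a
    -a*-a≡a*a = solve 1 (λ a → :- a :* :- a := a :* a) refl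

-- x ≈ℝ y unfolds to Null (λ n → seq x n - seq y n).
Null : (ℕ → ℚ) → Set
Null f = ∀ δ → 0ℚ ℚ.< δ → ∃ λ N → ∀ n → N ℕ.≤ n → ℚ.∣ f n ∣ ℚ.< δ

abstract

  null-cong : ∀ {f g} → (∀ n → f n ≡ g n) → Null f → Null g
  null-cong eq nf δ 0<δ =
    let N , p = nf δ 0<δ in N , λ n h → subst (λ q → ℚ.∣ q ∣ ℚ.< δ) (eq n) (p n h)

  null-zero : ∀ {f} → (∀ n → f n ≡ 0ℚ) → Null f
  null-zero eq δ 0<δ = 0 , λ n _ → subst (λ q → ℚ.∣ q ∣ ℚ.< δ) (≡.sym (eq n)) 0<δ

  null-+ : ∀ {f g} → Null f → Null g → Null (λ n → f n ℚ.+ g n)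
  null-+ {f} {g} nf ng δ 0<δ =
    let M , p = nf (½ ℚ.* δ) (half-pos 0<δ)
        N , q = ng (½ ℚ.* δ) (half-pos 0<δ)
    in M ℕ.⊔ N , λ n h → begin-strict
      ℚ.∣ f n ℚ.+ g n ∣              ≤⟨ ℚ.∣p+q∣≤∣p∣+∣q∣ (f n) (g n) ⟩
      ℚ.∣ f n ∣ ℚ.+ ℚ.∣ g n ∣        <⟨ ℚ.+-mono-< (p n (ℕ.m⊔n≤o⇒m≤o M N h)) (q n (ℕ.m⊔n≤o⇒n≤o M N h)) ⟩
      ½ ℚ.* δ ℚ.+ ½ ℚ.* δ            ≡⟨ halves δ ⟩
      δ                              ∎
    where open ℚ.≤-Reasoning

  null-neg : ∀ {f} → Null f → Null (λ n → ℚ.- f n)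
  null-neg {f} nf δ 0<δ =
    let N , p = nf δ 0<δ in N , λ n h → subst (ℚ._< δ) (≡.sym (ℚ.∣-p∣≡∣p∣ (f n))) (p n h)

  -- A Cauchy sequence is eventually bounded by some `B`, so it suffices that `g` falls below δ /
  -- `B`.
  cauchy*null : ∀ {f g} → IsCauchy f → Null g → Null (λ n → f n ℚ.* g n)
  cauchy*null {f} {g} cf ng δ 0<δ =
    let B , 0<B , M , b = eventually-bounded cf
        γ , 0<γ , Bγ    = divide 0<B 0<δ
        N , p           = ng γ 0<γ
    in M ℕ.⊔ N , λ n h →
      subst (ℚ.∣ f n ℚ.* g n ∣ ℚ.<_) Bγ
        (scale (f n) (g n) 0<B (b n (ℕ.m⊔n≤o⇒m≤o M N h)) (p n (ℕ.m⊔n≤o⇒n≤o M N h)))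

  pointwise : ∀ {x y} → (∀ n → seq x n ≡ seq y n) → x ≈ℝ y
  pointwise {x} {y} eq = null-zero λ n →
    ≡.trans (cong (ℚ._- seq y n) (eq n)) (ℚ.+-inverseʳ (seq y n))

  ≈ℝ-sym : ∀ {x y} → x ≈ℝ y → y ≈ℝ x
  ≈ℝ-sym {x} {y} p =
    null-cong (λ n → -[a-b]≡b-a (seq x n) (seq y n)) (null-neg p)

  ≈ℝ-trans : ∀ {x y z} → x ≈ℝ y → y ≈ℝ z → x ≈ℝ z
  ≈ℝ-trans {x} {y} {z} p q =
    null-cong (λ n → a-b+b-c≡a-c (seq x n) (seq y n) (seq z n))
      (null-+ p q)

  +ℝ-cong : ∀ {x x′ y y′} → x ≈ℝ x′ → y ≈ℝ y′ → x +ℝ y ≈ℝ x′ +ℝ y′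
  +ℝ-cong {x} {x′} {y} {y′} p q =
    null-cong (λ n → +-sub (seq x n) (seq x′ n) (seq y n) (seq y′ n))
      (null-+ p q)

  -ℝ-cong : ∀ {x y} → x ≈ℝ y → -ℝ x ≈ℝ -ℝ y
  -ℝ-cong {x} {y} p =
    null-cong (λ n → -‿sub (seq x n) (seq y n)) (null-neg p)

  *ℝ-cong : ∀ {x x′ y y′} → x ≈ℝ x′ → y ≈ℝ y′ → x *ℝ y ≈ℝ x′ *ℝ y′
  *ℝ-cong {x} {x′} {y} {y′} p q =
    null-cong (λ n → *-sub (seq x n) (seq x′ n) (seq y n) (seq y′ n))
      (null-+ (cauchy*null {seq x} (cauchy x) q) (cauchy*null {seq y′} (cauchy y′) p))

≈ℝ0⇒null : ∀ {x} → x ≈ℝ 0ℝ → Null (seq x)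
≈ℝ0⇒null {x} = null-cong (λ n → ℚ.+-identityʳ (seq x n))

null⇒≈ℝ0 : ∀ {x} → Null (seq x) → x ≈ℝ 0ℝ
null⇒≈ℝ0 {x} = null-cong (λ n → ≡.sym (ℚ.+-identityʳ (seq x n)))

-- Apartness from zero, cancellation and sums of squares

-- The positive form of being non-zero: an explicit lower bound, which a mere negation of `x ≈ℝ 0ℝ`
-- does not supply.
Apart : ℝ → Set
Apart x = ∃ λ q → 0ℚ ℚ.< q × ∃ λ N → ∀ n → N ℕ.≤ n → q ℚ.≤ ℚ.∣ seq x n ∣

abstract

  close-to-small : ∀ {γ η} a b → ℚ.∣ a ℚ.- b ∣ ℚ.< γ → ℚ.∣ b ∣ ℚ.< η → ℚ.∣ a ∣ ℚ.< γ ℚ.+ η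
  close-to-small {γ} {η} a b p q = begin-strict
    ℚ.∣ a ∣                      ≡⟨ cong ℚ.∣_∣ (a≡a-b+b a b) ⟩
    ℚ.∣ (a ℚ.- b) ℚ.+ b ∣        ≤⟨ ℚ.∣p+q∣≤∣p∣+∣q∣ (a ℚ.- b) b ⟩
    ℚ.∣ a ℚ.- b ∣ ℚ.+ ℚ.∣ b ∣    <⟨ ℚ.+-mono-< p q ⟩
    γ ℚ.+ η                      ∎
    where open ℚ.≤-Reasoning

  -- At a late index the sequence is either below δ/2, and then stays below δ,
  -- or at least δ/2, and then stays above δ/4.
  small-or-apart : ∀ x δ → 0ℚ ℚ.< δ →
    (∃ λ N → ∀ n → N ℕ.≤ n → ℚ.∣ seq x n ∣ ℚ.< δ) ⊎ Apart x
  small-or-apart x δ 0<δ = classify (cauchy x η 0<η)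
    where
    γ η : ℚ
    γ = ½ ℚ.* δ
    η = ½ ℚ.* γ
    0<η : 0ℚ ℚ.< η
    0<η = half-pos (half-pos 0<δ)
    η<γ : η ℚ.< γ
    η<γ = subst (η ℚ.<_) (halves γ)
            (subst (ℚ._< η ℚ.+ η) (ℚ.+-identityʳ η) (ℚ.+-monoʳ-< η 0<η))
    classify : (∃ λ N → ∀ m n → N ℕ.≤ m → N ℕ.≤ n → ℚ.∣ seq x m ℚ.- seq x n ∣ ℚ.< η) →
      (∃ λ N → ∀ n → N ℕ.≤ n → ℚ.∣ seq x n ∣ ℚ.< δ) ⊎ Apart x
    classify (N , p) with ℚ.∣ seq x N ∣ ℚ.<? γ
    ... | yes small = inj₁ (N , λ n h → subst (ℚ.∣ seq x n ∣ ℚ.<_) (halves δ)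
      (close-to-small (seq x n) (seq x N) (ℚ.<-trans (p n N h ℕ.≤-refl) η<γ) small))
    ... | no large = inj₂ (η , 0<η , N , λ n h → ℚ.≮⇒≥ λ x<η →
      large (subst (ℚ.∣ seq x N ∣ ℚ.<_) (halves γ)
        (close-to-small (seq x N) (seq x n) (p N n ℕ.≤-refl h) x<η)))

  apart⇒≉0 : ∀ {x} → Apart x → ¬ x ≈ℝ 0ℝ
  apart⇒≉0 {x} (q , 0<q , M , a) x≈0 =
    let N , p = ≈ℝ0⇒null {x} x≈0 q 0<q
    in ℚ.<-irrefl refl (ℚ.<-≤-trans (p (M ℕ.⊔ N) (ℕ.m≤n⊔m M N)) (a (M ℕ.⊔ N) (ℕ.m≤m⊔n M N)))

  -- For each δ, `small-or-apart` leaves only the small case. Together with `apart⇒≉0` this makes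
  -- vanishing equivalent to a negation, hence stable.
  ¬apart⇒≈0 : ∀ {x} → ¬ Apart x → x ≈ℝ 0ℝ
  ¬apart⇒≈0 {x} ¬a = null⇒≈ℝ0 {x} small
    where
    small : Null (seq x)
    small δ 0<δ with small-or-apart x δ 0<δ
    ... | inj₁ s = s
    ... | inj₂ a = contradiction a ¬a

  ≈ℝ0-stable : ∀ {x} → ¬ ¬ (x ≈ℝ 0ℝ) → x ≈ℝ 0ℝ
  ≈ℝ0-stable {x} ¬¬p = ¬apart⇒≈0 {x} λ a → ¬¬p (apart⇒≉0 {x} a)

  apart-cancel : ∀ {x y} → Apart x → x *ℝ y ≈ℝ 0ℝ → y ≈ℝ 0ℝ
  apart-cancel {x} {y} (q , 0<q , M , a) xy≈0 = null⇒≈ℝ0 {y} λ δ 0<δ →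
    -- Tolerance q δ: once |x| ≥ q, the bound |x y| < q δ forces |y| < δ.
    let 0<qδ  = ℚ.positive⁻¹ (q ℚ.* δ) {{ℚ.pos*pos⇒pos q {{ℚ.positive 0<q}} δ {{ℚ.positive 0<δ}}}}
        N , p = ≈ℝ0⇒null {x *ℝ y} xy≈0 (q ℚ.* δ) 0<qδ
    in M ℕ.⊔ N , λ n h → ℚ.*-cancelˡ-<-nonNeg q {{ℚ.pos⇒nonNeg q {{ℚ.positive 0<q}}}} (begin-strict
      q ℚ.* ℚ.∣ seq y n ∣
        ≤⟨ ℚ.*-monoʳ-≤-nonNeg ℚ.∣ seq y n ∣ {{ℚ.∣-∣-nonNeg (seq y n)}} (a n (ℕ.m⊔n≤o⇒m≤o M N h)) ⟩
      ℚ.∣ seq x n ∣ ℚ.* ℚ.∣ seq y n ∣    ≡⟨ ℚ.∣p*q∣≡∣p∣*∣q∣ (seq x n) (seq y n) ⟨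
      ℚ.∣ seq x n ℚ.* seq y n ∣          <⟨ p n (ℕ.m⊔n≤o⇒n≤o M N h) ⟩
      q ℚ.* δ                            ∎)
    where open ℚ.≤-Reasoning

  -- From `x≉0` only the double negation of `Apart x` follows; this is enough because the conclusion
  -- is stable.
  *ℝ-cancel : ∀ {x y} → ¬ x ≈ℝ 0ℝ → x *ℝ y ≈ℝ 0ℝ → y ≈ℝ 0ℝ
  *ℝ-cancel {x} {y} x≉0 xy≈0 = ≈ℝ0-stable {y} λ y≉0 →
    x≉0 (¬apart⇒≈0 {x} λ a → y≉0 (apart-cancel {x} {y} a xy≈0))

  -- If |x| is eventually at least q, then x² + y² is eventually at least q², so the sum is apart
  -- from zero.
  sumOfSquares≈0 : ∀ {x y} → x *ℝ x +ℝ y *ℝ y ≈ℝ 0ℝ → x ≈ℝ 0ℝ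
  sumOfSquares≈0 {x} {y} s≈0 = ¬apart⇒≈0 {x} λ (q , 0<q , M , a) →
    apart⇒≉0 {x *ℝ x +ℝ y *ℝ y}
      ( q ℚ.* q
      , ℚ.positive⁻¹ (q ℚ.* q) {{ℚ.pos*pos⇒pos q {{ℚ.positive 0<q}} q {{ℚ.positive 0<q}}}}
      , M
      , λ n h → begin
          q ℚ.* q
            ≤⟨ ℚ.*-monoˡ-≤-nonNeg q {{ℚ.pos⇒nonNeg q {{ℚ.positive 0<q}}}} (a n h) ⟩
          q ℚ.* ℚ.∣ seq x n ∣
            ≤⟨ ℚ.*-monoʳ-≤-nonNeg ℚ.∣ seq x n ∣ {{ℚ.∣-∣-nonNeg (seq x n)}} (a n h) ⟩
          ℚ.∣ seq x n ∣ ℚ.* ℚ.∣ seq x n ∣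
            ≡⟨ ∣p∣*∣p∣≡p*p (seq x n) ⟩
          seq x n ℚ.* seq x n
            ≡⟨ ℚ.+-identityʳ _ ⟨
          seq x n ℚ.* seq x n ℚ.+ 0ℚ
            ≤⟨ ℚ.+-monoʳ-≤ (seq x n ℚ.* seq x n) (0≤p*p (seq y n)) ⟩
          seq x n ℚ.* seq x n ℚ.+ seq y n ℚ.* seq y n
            ≤⟨ p≤∣p∣ _ ⟩
          ℚ.∣ seq x n ℚ.* seq x n ℚ.+ seq y n ℚ.* seq y n ∣ ∎ )
      s≈0
    where
    open ℚ.≤-Reasoning
    ∣p∣*∣p∣≡p*p : ∀ p → ℚ.∣ p ∣ ℚ.* ℚ.∣ p ∣ ≡ p ℚ.* p
    ∣p∣*∣p∣≡p*p p with ℚ.∣p∣≡p∨∣p∣≡-p p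
    ... | inj₁ eq = cong₂ ℚ._*_ eq eq
    ... | inj₂ eq = ≡.trans (cong₂ ℚ._*_ eq eq) (-a*-a≡a*a p)
    0≤p*p : ∀ p → 0ℚ ℚ.≤ p ℚ.* p
    0≤p*p p = subst (0ℚ ℚ.≤_) (≡.trans (ℚ.∣p*q∣≡∣p∣*∣q∣ p p) (∣p∣*∣p∣≡p*p p)) (ℚ.0≤∣p∣ (p ℚ.* p))
    p≤∣p∣ : ∀ p → p ℚ.≤ ℚ.∣ p ∣
    p≤∣p∣ p with ℚ.≤-total 0ℚ p
    ... | inj₁ 0≤p = ℚ.≤-reflexive (≡.sym (ℚ.0≤p⇒∣p∣≡p 0≤p))
    ... | inj₂ p≤0 = ℚ.≤-trans p≤0 (ℚ.0≤∣p∣ p)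

  1ℝ≉0ℝ : ¬ 1ℝ ≈ℝ 0ℝ
  1ℝ≉0ℝ = apart⇒≉0 {1ℝ} (1ℚ , ℚ.positive⁻¹ 1ℚ , 0 , λ _ _ → ℚ.≤-refl)

-- The ring of complex numbers

-ℂ_ : ℂ → ℂ
-ℂ z = (-ℝ re z) +i (-ℝ im z)

-- All ring laws of ℂ hold termwise for the underlying rational sequences.
ℂ-commutativeRing : CommutativeRing 0ℓ 0ℓ
ℂ-commutativeRing = record
  { Carrier = ℂ ; _≈_ = _≈_ ; _+_ = _+ℂ_ ; _*_ = _*ℂ_ ; -_ = -ℂ_ ; 0# = 0ℂ ; 1# = 1ℂ
  ; isCommutativeRing = record
    { isRing = record
      { +-isAbelianGroup = record
        { isGroup = record
          { isMonoid = record
            { isSemigroup = record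
              { isMagma = record
                { isEquivalence = record
                  { refl  = λ {z} → pointwise {re z} {re z} (λ _ → refl) , pointwise {im z} {im z} (λ _ → refl)
                  ; sym   = λ {z} {w} (p , q) → ≈ℝ-sym {re z} {re w} p , ≈ℝ-sym {im z} {im w} q
                  ; trans = λ {z} {w} {v} → ≈-trans z w v
                  }
                ; ∙-cong = λ {x} {y} {u} {v} → +-cong x y u v
                }
              ; assoc = +-assoc
              }
            ; identity = +-identityˡ , +-identityʳ
            }
          ; inverse = -‿inverseˡ , -‿inverseʳ
          ; ⁻¹-cong = λ {z} {w} (p , q) → -ℝ-cong {re z} {re w} p , -ℝ-cong {im z} {im w} q
          }
        ; comm = +-comm
        }
      ; *-cong = λ {x} {y} {u} {v} → *-cong x y u v
      ; *-assoc = *-assoc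
      ; *-identity = *-identityˡ , *-identityʳ
      ; distrib = distribˡ , distribʳ
      }
    ; *-comm = *-comm
    }
  }
  where
  ptw : ∀ z w → (∀ n → seq (re z) n ≡ seq (re w) n) → (∀ n → seq (im z) n ≡ seq (im w) n) → z ≈ w
  ptw z w p q = pointwise {re z} {re w} p , pointwise {im z} {im w} q
  R I : ℂ → ℕ → ℚ
  R z = seq (re z)
  I z = seq (im z)
  ≈-trans : ∀ z w v → z ≈ w → w ≈ v → z ≈ v
  ≈-trans z w v (p , q) (r , s) =
    ≈ℝ-trans {re z} {re w} {re v} p r , ≈ℝ-trans {im z} {im w} {im v} q s
  abstract
    +-cong : ∀ x y u v → x ≈ y → u ≈ v → x +ℂ u ≈ y +ℂ v
    +-cong x y u v (p , q) (r , s) =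
      +ℝ-cong {re x} {re y} {re u} {re v} p r , +ℝ-cong {im x} {im y} {im u} {im v} q s
    *-cong : ∀ x y u v → x ≈ y → u ≈ v → x *ℂ u ≈ y *ℂ v
    *-cong x y u v (p , q) (r , s) =
      +ℝ-cong {re x *ℝ re u} {re y *ℝ re v} { -ℝ (im x *ℝ im u)} { -ℝ (im y *ℝ im v)}
        (*ℝ-cong {re x} {re y} {re u} {re v} p r)
        (-ℝ-cong {im x *ℝ im u} {im y *ℝ im v} (*ℝ-cong {im x} {im y} {im u} {im v} q s)) ,
      +ℝ-cong {re x *ℝ im u} {re y *ℝ im v} {im x *ℝ re u} {im y *ℝ re v}
        (*ℝ-cong {re x} {re y} {im u} {im v} p s) (*ℝ-cong {im x} {im y} {re u} {re v} q r)
    +-assoc : ∀ x y z → (x +ℂ y) +ℂ z ≈ x +ℂ (y +ℂ z)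
    +-assoc x y z = ptw ((x +ℂ y) +ℂ z) (x +ℂ (y +ℂ z))
      (λ n → ℚ.+-assoc (R x n) (R y n) (R z n)) (λ n → ℚ.+-assoc (I x n) (I y n) (I z n))
    +-comm : ∀ x y → x +ℂ y ≈ y +ℂ x
    +-comm x y = ptw (x +ℂ y) (y +ℂ x) (λ n → ℚ.+-comm (R x n) (R y n)) (λ n → ℚ.+-comm (I x n) (I y n))
    +-identityˡ : ∀ x → 0ℂ +ℂ x ≈ x
    +-identityˡ x = ptw (0ℂ +ℂ x) x (λ n → ℚ.+-identityˡ (R x n)) (λ n → ℚ.+-identityˡ (I x n))
    +-identityʳ : ∀ x → x +ℂ 0ℂ ≈ x
    +-identityʳ x = ptw (x +ℂ 0ℂ) x (λ n → ℚ.+-identityʳ (R x n)) (λ n → ℚ.+-identityʳ (I x n))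
    -‿inverseˡ : ∀ x → (-ℂ x) +ℂ x ≈ 0ℂ
    -‿inverseˡ x = ptw ((-ℂ x) +ℂ x) 0ℂ (λ n → ℚ.+-inverseˡ (R x n)) (λ n → ℚ.+-inverseˡ (I x n))
    -‿inverseʳ : ∀ x → x +ℂ (-ℂ x) ≈ 0ℂ
    -‿inverseʳ x = ptw (x +ℂ (-ℂ x)) 0ℂ (λ n → ℚ.+-inverseʳ (R x n)) (λ n → ℚ.+-inverseʳ (I x n))
    *-comm : ∀ x y → x *ℂ y ≈ y *ℂ x
    *-comm x y = ptw (x *ℂ y) (y *ℂ x)
      (λ n → re-*-comm (R x n) (I x n) (R y n) (I y n))
      (λ n → im-*-comm (R x n) (I x n) (R y n) (I y n))
    *-assoc : ∀ x y z → (x *ℂ y) *ℂ z ≈ x *ℂ (y *ℂ z)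
    *-assoc x y z = ptw ((x *ℂ y) *ℂ z) (x *ℂ (y *ℂ z))
      (λ n → re-*-assoc (R x n) (I x n) (R y n) (I y n) (R z n) (I z n))
      (λ n → im-*-assoc (R x n) (I x n) (R y n) (I y n) (R z n) (I z n))
    *-identityˡ : ∀ x → 1ℂ *ℂ x ≈ x
    *-identityˡ x = ptw (1ℂ *ℂ x) x
      (λ n → re-*-identityˡ (R x n) (I x n))
      (λ n → im-*-identityˡ (R x n) (I x n))
    *-identityʳ : ∀ x → x *ℂ 1ℂ ≈ x
    *-identityʳ x = ≈-trans (x *ℂ 1ℂ) (1ℂ *ℂ x) x (*-comm x 1ℂ) (*-identityˡ x)
    distribˡ : ∀ x y z → x *ℂ (y +ℂ z) ≈ (x *ℂ y) +ℂ (x *ℂ z)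
    distribˡ x y z = ptw (x *ℂ (y +ℂ z)) ((x *ℂ y) +ℂ (x *ℂ z))
      (λ n → re-distribˡ (R x n) (I x n) (R y n) (I y n) (R z n) (I z n))
      (λ n → im-distribˡ (R x n) (I x n) (R y n) (I y n) (R z n) (I z n))
    distribʳ : ∀ x y z → (y +ℂ z) *ℂ x ≈ (y *ℂ x) +ℂ (z *ℂ x)
    distribʳ x y z = ≈-trans ((y +ℂ z) *ℂ x) (x *ℂ (y +ℂ z)) ((y *ℂ x) +ℂ (z *ℂ x)) (*-comm (y +ℂ z) x)
      (≈-trans (x *ℂ (y +ℂ z)) ((x *ℂ y) +ℂ (x *ℂ z)) ((y *ℂ x) +ℂ (z *ℂ x)) (distribˡ x y z)
        (+-cong (x *ℂ y) (y *ℂ x) (x *ℂ z) (z *ℂ x) (*-comm x y) (*-comm x z)))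

≈0-stable : ∀ {z} → ¬ ¬ (z ≈ 0ℂ) → z ≈ 0ℂ
≈0-stable {z} ¬¬p =
  ≈ℝ0-stable {re z} (λ ¬p → ¬¬p λ (p , _) → ¬p p) ,
  ≈ℝ0-stable {im z} (λ ¬p → ¬¬p λ (_ , p) → ¬p p)

1ℂ≉0ℂ : ¬ 1ℂ ≈ 0ℂ
1ℂ≉0ℂ (p , _) = 1ℝ≉0ℝ p

abstract

  -- Multiplying z w by conj z turns it into |z|² w, which reduces the claim to ℝ.
  *ℂ-cancel : ∀ {z w} → ¬ z ≈ 0ℂ → z *ℂ w ≈ 0ℂ → w ≈ 0ℂ
  *ℂ-cancel {z} {w} z≉0 (p , q) =
    *ℝ-cancel {norm} {re w} norm≉0
      (null⇒≈ℝ0 {norm *ℝ re w}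
        (null-cong
          (λ n → re-norm-* (seq (re z) n) (seq (im z) n) (seq (re w) n) (seq (im w) n))
          (null-+ (cauchy*null {seq (re z)} (cauchy (re z)) (≈ℝ0⇒null {re (z *ℂ w)} p))
                  (cauchy*null {seq (im z)} (cauchy (im z)) (≈ℝ0⇒null {im (z *ℂ w)} q))))) ,
    *ℝ-cancel {norm} {im w} norm≉0
      (null⇒≈ℝ0 {norm *ℝ im w}
        (null-cong
          (λ n → im-norm-* (seq (re z) n) (seq (im z) n) (seq (re w) n) (seq (im w) n))
          (null-+ (cauchy*null {seq (re z)} (cauchy (re z)) (≈ℝ0⇒null {im (z *ℂ w)} q))
                  (null-neg (cauchy*null {seq (im z)} (cauchy (im z)) (≈ℝ0⇒null {re (z *ℂ w)} p))))))
    where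
    norm : ℝ
    norm = re z *ℝ re z +ℝ im z *ℝ im z
    norm≉0 : ¬ norm ≈ℝ 0ℝ
    norm≉0 s = z≉0
      ( sumOfSquares≈0 {re z} {im z} s
      , sumOfSquares≈0 {im z} {re z}
          (null-cong (λ n → norm-comm (seq (re z) n) (seq (im z) n)) s) )

  unit≉0 : ∀ {z} → HasUnitModulus z → ¬ z ≈ 0ℂ
  unit≉0 {z} ∣z∣≈1 (p , q) = 1ℝ≉0ℝ
    (≈ℝ-trans {1ℝ} {norm} {0ℝ} (≈ℝ-sym {norm} {1ℝ} ∣z∣≈1)
      (null⇒≈ℝ0 {norm} (null-+ (cauchy*null {seq (re z)} (cauchy (re z)) (≈ℝ0⇒null {re z} p))
                               (cauchy*null {seq (im z)} (cauchy (im z)) (≈ℝ0⇒null {im z} q)))))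
    where
    norm : ℝ
    norm = re z *ℝ re z +ℝ im z *ℝ im z

-- Cyclomatic number under vertex deletion

AllPairs-lookup : ∀ {A : Set} {R : Rel A 0ℓ} {xs} → AllPairs R xs →
  ∀ {i j} → i Fin.< j → R (lookup xs i) (lookup xs j)
AllPairs-lookup {xs = x ∷ xs} (Rx ∷ _)  {zero}  {suc j} _             = All.lookup Rx (∈-lookup j)
AllPairs-lookup {xs = x ∷ xs} (_ ∷ Rxs) {suc i} {suc j} (ℕ.s≤s i<j) = AllPairs-lookup Rxs i<j

-- Pigeonhole: `cover` sends positions of `xs` to positions of `ys`, and a collision would relate
-- two separated elements by `join`. It is used with equality to count edges and with connectedness
-- to count components.
length-≤ : ∀ {A B : Set} {_~_ : Rel A 0ℓ} {xs : List A} {ys : List B} (R : A → B → Set) →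
  (∀ {x x′ y} → R x y → R x′ y → x ~ x′) →
  AllPairs (λ x x′ → ¬ x ~ x′) xs → (∀ {x} → x ∈ˡ xs → Any (R x) ys) → length xs ℕ.≤ length ys
length-≤ {_~_ = _~_} {xs} {ys} R join separated cover = Fin.injective⇒≤ f-injective
  where
  f : Fin (length xs) → Fin (length ys)
  f i = Any.index (cover (∈-lookup i))
  same : ∀ i j → f i ≡ f j → lookup xs i ~ lookup xs j
  same i j eq = join
    (subst (λ k → R (lookup xs i) (lookup ys k)) eq (Any.lookup-index (cover (∈-lookup i))))
    (Any.lookup-index (cover (∈-lookup j)))
  f-injective : ∀ {i j} → f i ≡ f j → i ≡ j
  f-injective {i} {j} eq with Fin.<-cmp i j
  ... | tri< i<j _ _ = contradiction (same i j eq) (AllPairs-lookup separated i<j)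
  ... | tri≈ _ i≡j _ = i≡j
  ... | tri> _ _ j<i = contradiction (same j i (≡.sym eq)) (AllPairs-lookup separated j<i)

unique-length-≤ : ∀ {A : Set} {xs ys : List A} → Unique xs → (∀ {x} → x ∈ˡ xs → x ∈ˡ ys) → length xs ℕ.≤ length ys
unique-length-≤ = length-≤ _≡_ (λ p q → ≡.trans p (≡.sym q))

module _ {n} (G : Graph n) where

  connected-sym : ∀ {i j} → Connected G i j → Connected G j i
  connected-sym = reverse (symm G)

  connectedDecSetoid : DecSetoid 0ℓ 0ℓ
  connectedDecSetoid = record
    { Carrier = Fin n ; _≈_ = Connected G
    ; isDecEquivalence = record
      { isEquivalence = record { refl = ε ; sym = connected-sym ; trans = _◅◅_ } ; _≟_ = connected? G } }

  representatives : List (Fin n)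
  representatives = deduplicate (connected? G) (allFin n)

  representatives-separated : AllPairs (λ i j → ¬ Connected G i j) representatives
  representatives-separated = Unique.deduplicate-! connectedDecSetoid (allFin n)

  representatives-cover : ∀ i → Any (Connected G i) representatives
  representatives-cover i = Any.deduplicate⁺ (connected? G) (λ p q → q ◅◅ connected-sym p)
    (Any.map (λ { refl → ε }) (∈-allFin i))

  neighbours : Fin n → List (Fin n)
  neighbours i = filter (adj? G i) (allFin n)

  edges : List (Fin n × Fin n)
  edges = filter (λ (i , j) → (i Fin.<? j) ×-dec adj? G i j) (cartesianProduct (allFin n) (allFin n))

  ∈-edges⁺ : ∀ {i j} → i Fin.< j → Adj G i j → (i , j) ∈ˡ edges
  ∈-edges⁺ i<j e = ∈-filter⁺ _ (∈-cartesianProduct⁺ (∈-allFin _) (∈-allFin _)) (i<j , e)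

  ∈-edges⁻ : ∀ {i j} → (i , j) ∈ˡ edges → i Fin.< j × Adj G i j
  ∈-edges⁻ = proj₂ ∘ ∈-filter⁻ _ {xs = cartesianProduct (allFin n) (allFin n)}

  ∈-neighbours⁻ : ∀ {i j} → j ∈ˡ neighbours i → Adj G i j
  ∈-neighbours⁻ {i} = proj₂ ∘ ∈-filter⁻ (adj? G i) {xs = allFin n}

  ∈-neighbours⁺ : ∀ {i j} → Adj G i j → j ∈ˡ neighbours i
  ∈-neighbours⁺ {i} = ∈-filter⁺ (adj? G i) (∈-allFin _)

module _ {n} (G : Graph (suc n)) (x : Fin (suc n)) where

  private
    H : Graph n
    H = deleteᴳ G x

  adj-punchOut : ∀ {i j} (x≢i : x ≢ i) (x≢j : x ≢ j) → Adj G i j → Adj H (punchOut x≢i) (punchOut x≢j)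
  adj-punchOut x≢i x≢j =
    subst₂ (Adj G) (≡.sym (Fin.punchIn-punchOut x≢i)) (≡.sym (Fin.punchIn-punchOut x≢j))

  -- The edge between `x` and `y` in the form in which `edges` lists it, smaller end first.
  orient : Fin (suc n) → Fin (suc n) × Fin (suc n)
  orient y with x Fin.<? y
  ... | yes _ = x , y
  ... | no  _ = y , x

  orient-injective : ∀ {y z} → orient y ≡ orient z → y ≡ z
  orient-injective {y} {z} eq with x Fin.<? y | x Fin.<? z
  ... | yes _ | yes _ = cong proj₂ eq
  ... | yes _ | no  _ = ≡.trans (cong proj₂ eq) (cong proj₁ eq)
  ... | no  _ | yes _ = ≡.trans (cong proj₁ eq) (cong proj₂ eq)
  ... | no  _ | no  _ = cong proj₁ eq

  orient∈edges : ∀ {y} → Adj G x y → orient y ∈ˡ edges G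
  orient∈edges {y} e with x Fin.<? y
  ... | yes x<y = ∈-edges⁺ G x<y e
  ... | no  x≮y = ∈-edges⁺ G (Fin.≤∧≢⇒< (ℕ.≮⇒≥ x≮y) (adj⇒≢ G e ∘ ≡.sym)) (symm G e)

  orient-misses : ∀ {i j} y → (punchIn x i , punchIn x j) ≢ orient y
  orient-misses {i} {j} y eq with x Fin.<? y
  ... | yes _ = Fin.punchInᵢ≢i x i (cong proj₁ eq)
  ... | no  _ = Fin.punchInᵢ≢i x j (cong proj₂ eq)

  punchIn² : Fin n × Fin n → Fin (suc n) × Fin (suc n)
  punchIn² (i , j) = punchIn x i , punchIn x j

  punchIn²-injective : ∀ {p q} → punchIn² p ≡ punchIn² q → p ≡ q
  punchIn²-injective eq =
    cong₂ _,_ (Fin.punchIn-injective x _ _ (cong proj₁ eq)) (Fin.punchIn-injective x _ _ (cong proj₂ eq))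

  punchIn-mono-< : ∀ {i j : Fin n} → i Fin.< j → punchIn x i Fin.< punchIn x j
  punchIn-mono-< {i} {j} i<j = Fin.≤∧≢⇒< (Fin.punchIn-mono-≤ x i j (ℕ.<⇒≤ i<j))
    (Fin.<⇒≢ i<j ∘ Fin.punchIn-injective x i j)

  -- The renumbered edges of `H` and the edges at `x` form two disjoint families of edges of `G`.
  edgeCount-delete : edgeCount H ℕ.+ degree G x ℕ.≤ edgeCount G
  edgeCount-delete = subst (ℕ._≤ edgeCount G)
    (≡.trans (List.length-++ old)
      (cong₂ ℕ._+_ (List.length-map punchIn² (edges H)) (List.length-map orient (neighbours G x))))
    (unique-length-≤ (Unique.++⁺ old! new! disjoint) ⊆edges)
    where
    old new : List (Fin (suc n) × Fin (suc n))
    old = map punchIn² (edges H)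
    new = map orient (neighbours G x)
    old! : Unique old
    old! = Unique.map⁺ punchIn²-injective
      (Unique.filter⁺ _ (Unique.cartesianProduct⁺ (Unique.allFin⁺ n) (Unique.allFin⁺ n)))
    new! : Unique new
    new! = Unique.map⁺ orient-injective (Unique.filter⁺ (adj? G x) (Unique.allFin⁺ (suc n)))
    disjoint : ∀ {e} → ¬ (e ∈ˡ old × e ∈ˡ new)
    disjoint (e∈old , e∈new) with ∈-map⁻ punchIn² e∈old | ∈-map⁻ orient e∈new
    ... | _ , _ , refl | y , _ , eq = orient-misses y eq
    ⊆edges : ∀ {e} → e ∈ˡ old ++ new → e ∈ˡ edges G
    ⊆edges e∈ with ∈-++⁻ old e∈
    ... | inj₁ e∈old with ∈-map⁻ punchIn² e∈old
    ...   | _ , ij∈ , refl = let i<j , e = ∈-edges⁻ H ij∈ in ∈-edges⁺ G (punchIn-mono-< i<j) e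
    ⊆edges e∈ | inj₂ e∈new with ∈-map⁻ orient e∈new
    ...   | _ , y∈ , refl = orient∈edges (∈-neighbours⁻ G y∈)

  -- Relates a vertex of `H` to a vertex of `G` in the old numbering; that `y` differs from `x` is
  -- implicit in the form `punchIn x j`.
  Reaches : Fin n → Fin (suc n) → Set
  Reaches i y = ∃ λ j → punchIn x j ≡ y × Connected H i j

  reaches-join : ∀ {i j y} → Reaches i y → Reaches j y → Connected H i j
  reaches-join {i} {j} (k , refl , p) (l , eq , q) =
    p ◅◅ connected-sym H (subst (Connected H j) (Fin.punchIn-injective x l k eq) q)

  reaches-prepend : ∀ {i j y} → Connected H i j → Reaches j y → Reaches i y
  reaches-prepend p (k , eq , q) = k , eq , p ◅◅ q

  -- Follow the walk until it first steps onto `x`: the vertex before that step is a neighbour of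
  -- `x`. If this never happens, the whole walk lies in `H`.
  escape : ∀ {i k j} → punchIn x i ≡ k → Connected G k j →
    (∃ λ l → Connected H i l × Adj G x (punchIn x l)) ⊎ Reaches i j
  escape {i} eq ε = inj₂ (i , eq , ε)
  escape {i} refl (_◅_ {j = k} e w) with x Fin.≟ k
  ... | yes refl = inj₁ (i , ε , symm G e)
  ... | no x≢k = go (escape (Fin.punchIn-punchOut x≢k) w)
    where
    e′ : Adj H i (punchOut x≢k)
    e′ = subst (Adj G (punchIn x i)) (≡.sym (Fin.punchIn-punchOut x≢k)) e
    go : (∃ λ l → Connected H (punchOut x≢k) l × Adj G x (punchIn x l)) ⊎ Reaches (punchOut x≢k) _ → _
    go (inj₁ (l , p , a)) = inj₁ (l , e′ ◅ p , a)
    go (inj₂ r) = inj₂ (reaches-prepend (e′ ◅ ε) r)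

  -- Every component of G - x contains a neighbour of x or is a component of G.
  componentCount-delete : (ns : List (Fin (suc n))) → (∀ j → Adj G x (punchIn x j) → Any (Reaches j) ns) →
    suc (componentCount H) ℕ.≤ length ns ℕ.+ componentCount G
  componentCount-delete ns near = begin
    suc (componentCount H)                  ≤⟨ ℕ.s≤s few ⟩
    suc (length (ns ++ far))                ≡⟨ cong suc (List.length-++ ns) ⟩
    suc (length ns ℕ.+ length far)          ≡⟨ ℕ.+-suc (length ns) (length far) ⟨
    length ns ℕ.+ suc (length far)          ≤⟨ ℕ.+-monoʳ-≤ (length ns) far< ⟩
    length ns ℕ.+ componentCount G          ∎
    where
    open ℕ.≤-Reasoning
    unreached? = λ r → ¬? (connected? G x r)
    far : List (Fin (suc n))
    far = filter unreached? (representatives G)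
    -- The representative of the component of `x` is filtered out, whence the strict inequality and
    -- the `suc` in the statement.
    far< : length far ℕ.< componentCount G
    far< = List.filter-notAll unreached? (representatives G) (Any.map (λ c ¬c → ¬c c) (representatives-cover G x))
    cover : ∀ i → Any (Reaches i) (ns ++ far)
    cover i with find (representatives-cover G (punchIn x i))
    ... | r , r∈ , c with connected? G x r
    ...   | yes x~r = near-cover (escape refl (c ◅◅ connected-sym G x~r))
      where
      near-cover : (∃ λ l → Connected H i l × Adj G x (punchIn x l)) ⊎ Reaches i x → Any (Reaches i) (ns ++ far)
      near-cover (inj₁ (l , p , a)) = Any.++⁺ˡ (Any.map (reaches-prepend p) (near l a))
      near-cover (inj₂ (l , eq , _)) = contradiction eq (Fin.punchInᵢ≢i x l)
    ...   | no x≁r with escape refl c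
    ...     | inj₁ (l , p , a) = Any.++⁺ˡ (Any.map (reaches-prepend p) (near l a))
    ...     | inj₂ r~ = Any.++⁺ʳ ns (lose (∈-filter⁺ unreached? r∈ x≁r) r~)
    few : componentCount H ℕ.≤ length (ns ++ far)
    few = length-≤ Reaches reaches-join (representatives-separated H) λ {i} _ → cover i

  -- Deleting `x` loses `degree G x` edges and one vertex, and gains at most `length ns` - 1
  -- components, where `ns` meets every component of `H` that contains a neighbour of `x`. The slack
  -- `k` between `ns` and the degree is the drop in `θ`.
  θ-delete : (ns : List (Fin (suc n))) → (∀ j → Adj G x (punchIn x j) → Any (Reaches j) ns) →
    ∀ k → length ns ℕ.+ k ℕ.≤ degree G x → θ H ℤ.+ + k ℤ.≤ θ G
  θ-delete ns near k short = begin
    θ H ℤ.+ + k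
      ≡⟨ solve 4 (λ e n c k → e :- n :+ c :+ k := (e :+ c :+ con (+ 1) :+ k) :- (con (+ 1) :+ n)) refl
           (+ edgeCount H) (+ n) (+ componentCount H) (+ k) ⟩
    + (edgeCount H ℕ.+ componentCount H ℕ.+ 1 ℕ.+ k) ℤ.- + suc n
      ≤⟨ ℤ.+-monoˡ-≤ (ℤ.- + suc n) (ℤ.+≤+ counts) ⟩
    + (edgeCount G ℕ.+ componentCount G) ℤ.- + suc n
      ≡⟨ solve 3 (λ e n c → (e :+ c) :- n := e :- n :+ c) refl (+ edgeCount G) (+ suc n) (+ componentCount G) ⟩
    θ G ∎
    where
    open ℤ.≤-Reasoning
    open ℤ.+-*-Solver
    counts : edgeCount H ℕ.+ componentCount H ℕ.+ 1 ℕ.+ k ℕ.≤ edgeCount G ℕ.+ componentCount G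
    counts = ℕ.+-cancelˡ-≤ (length ns) _ _ (subst₂ ℕ._≤_
      (lhs (edgeCount H) (componentCount H) k (length ns)) (rhs (edgeCount G) (componentCount G) (length ns))
      (ℕ.+-mono-≤ (ℕ.≤-trans (ℕ.+-monoʳ-≤ (edgeCount H) short) edgeCount-delete) (componentCount-delete ns near)))
      where
      lhs : ∀ e c k l → e ℕ.+ (l ℕ.+ k) ℕ.+ suc c ≡ l ℕ.+ (e ℕ.+ c ℕ.+ 1 ℕ.+ k)
      lhs = N.solve 4 (λ e c k l → e N.:+ (l N.:+ k) N.:+ (N.con 1 N.:+ c) N.:= l N.:+ (e N.:+ c N.:+ N.con 1 N.:+ k)) refl
        where module N = ℕ.+-*-Solver
      rhs : ∀ e c l → e ℕ.+ (l ℕ.+ c) ≡ l ℕ.+ (e ℕ.+ c)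
      rhs = N.solve 3 (λ e c l → e N.:+ (l N.:+ c) N.:= l N.:+ (e N.:+ c)) refl
        where module N = ℕ.+-*-Solver

  θ-delete-≤ : θ H ℤ.≤ θ G
  θ-delete-≤ = subst (ℤ._≤ θ G) (ℤ.+-identityʳ (θ H))
    (θ-delete (neighbours G x) (λ j a → lose (∈-neighbours⁺ G a) (j , refl , ε)) 0
      (ℕ.≤-reflexive (ℕ.+-identityʳ _)))

  -- Equivalently, x lies on a cycle.
  TwoLinkedNeighbours : Set
  TwoLinkedNeighbours = ∃₂ λ i j → i ≢ j × Adj G x (punchIn x i) × Adj G x (punchIn x j) × Connected H i j

  -- One neighbour can be left out of `ns`, since the other linked neighbour already represents its
  -- component; this is slack 1.
  θ-delete-< : TwoLinkedNeighbours → θ H ℤ.+ + 1 ℤ.≤ θ G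
  θ-delete-< (i , j , i≢j , x~i , x~j , i~j) = θ-delete ns near 1
    (subst (ℕ._≤ degree G x) (ℕ.+-comm 1 (length ns)) (List.filter-notAll ≢i? (neighbours G x)
      (Any.map (λ { refl ≢ → ≢ refl }) (∈-neighbours⁺ G x~i))))
    where
    ≢i? = λ y → ¬? (y Fin.≟ punchIn x i)
    ns : List (Fin (suc n))
    ns = filter ≢i? (neighbours G x)
    near : ∀ k → Adj G x (punchIn x k) → Any (Reaches k) ns
    near k x~k with punchIn x k Fin.≟ punchIn x i
    ... | yes eq = lose
      (∈-filter⁺ ≢i? (∈-neighbours⁺ G x~j) (i≢j ∘ ≡.sym ∘ Fin.punchIn-injective x j i))
      (j , refl , subst (λ k → Connected H k j) (≡.sym (Fin.punchIn-injective x k i eq)) i~j)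
    ... | no ≢ = lose (∈-filter⁺ ≢i? (∈-neighbours⁺ G x~k) ≢) (k , refl , ε)

  connected-along : ∀ {y ys z} → Linked (Adj G) (y ∷ ys) → All (x ≢_) (y ∷ ys) → z ∈ˡ y ∷ ys →
    (x≢y : x ≢ y) (x≢z : x ≢ z) → Connected H (punchOut x≢y) (punchOut x≢z)
  connected-along _ _ (here refl) x≢y x≢z = subst (Connected H (punchOut x≢y)) (Fin.punchOut-cong x refl) ε
  connected-along (e ∷ path) (_ ∷ avoid@(x≢y′ ∷ _)) (there z∈) x≢y x≢z =
    adj-punchOut x≢y x≢y′ e ◅ connected-along path avoid z∈ x≢y′ x≢z

  twoLinkedNeighbours : ∀ {y z} (x≢y : x ≢ y) (x≢z : x ≢ z) → y ≢ z → Adj G x y → Adj G x z →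
    Connected H (punchOut x≢y) (punchOut x≢z) → TwoLinkedNeighbours
  twoLinkedNeighbours x≢y x≢z y≢z x~y x~z y~z =
    punchOut x≢y , punchOut x≢z , y≢z ∘ Fin.punchOut-injective x≢y x≢z ,
    subst (Adj G x) (≡.sym (Fin.punchIn-punchOut x≢y)) x~y ,
    subst (Adj G x) (≡.sym (Fin.punchIn-punchOut x≢z)) x~z , y~z

-- Isolated vertices, pendant vertices and maximal paths

module _ {n} (G : Graph (suc n)) where

  open DecMembership (Fin._≟_ {suc n}) using (_∈?_)

  Isolated : Fin (suc n) → Set
  Isolated x = ∀ y → ¬ Adj G x y

  OnlyNeighbour : Fin (suc n) → Fin (suc n) → Set
  OnlyNeighbour x y = Adj G x y × (∀ z → Adj G x z → z ≡ y)

  -- A path is prolonged at its head x until a neighbour of x, other than its successor y, is on the path.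
  grow : (∀ {x y} → Adj G x y → ∃ λ z → z ≢ y × Adj G x z) →
    ∀ fuel {x y ys} → Linked (Adj G) (x ∷ y ∷ ys) → Unique (x ∷ y ∷ ys) →
    suc (suc n) ℕ.≤ fuel ℕ.+ length (x ∷ y ∷ ys) → ∃ (TwoLinkedNeighbours G)
  -- With no fuel left the path would have at least n + 2 distinct vertices among n + 1.
  grow other zero {x} {y} {ys} path unique long = contradiction
    (ℕ.≤-trans (unique-length-≤ unique (λ _ → ∈-allFin _)) (ℕ.≤-reflexive (List.length-tabulate (λ i → i))))
    (ℕ.<⇒≱ long)
  grow other (suc fuel) {x} {y} {ys} path@(x~y ∷ rest) unique@(avoid@(x≢y ∷ _) ∷ _) long with other x~y
  ... | z , z≢y , x~z with z ∈? (x ∷ y ∷ ys)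
  ...   | yes (here refl) = contradiction x~z (irrefl G)
  -- The rest of the path avoids `x` and joins its two neighbours `y` and `z`.
  ...   | yes (there z∈) = x , twoLinkedNeighbours G x x≢y (adj⇒≢ G x~z) (z≢y ∘ ≡.sym) x~y x~z
                                 (connected-along G x rest avoid z∈ x≢y (adj⇒≢ G x~z))
  ...   | no z∉ = grow other fuel (symm G x~z ∷ path) (All.¬Any⇒All¬ _ z∉ ∷ unique)
                    (ℕ.≤-trans long (ℕ.≤-reflexive (≡.sym (ℕ.+-suc fuel (length (x ∷ y ∷ ys))))))

  -- The case distinction of the rank induction, decided by finite search. When the first two
  -- searches fail, every neighbour of a vertex is accompanied by another one, so a path can be
  -- grown from any edge.
  trichotomy : ∃ Isolated ⊎ ∃₂ OnlyNeighbour ⊎ ∃ (TwoLinkedNeighbours G)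
  trichotomy with Fin.any? (λ x → Fin.all? (λ y → ¬? (adj? G x y)))
  ... | yes isolated = inj₁ isolated
  ... | no ¬isolated with Fin.any? (λ x → Fin.any? (λ y → adj? G x y ×-dec Fin.all? (λ z → adj? G x z →-dec (z Fin.≟ y))))
  ...   | yes pendant = inj₂ (inj₁ pendant)
  ...   | no ¬pendant = inj₂ (inj₂ (start neighbour))
    where
    neighbour : ∃ (Adj G zero)
    neighbour with Fin.any? (adj? G zero)
    ... | yes a = a
    ... | no ¬a = contradiction (zero , λ y a → ¬a (y , a)) ¬isolated
    other : ∀ {x y} → Adj G x y → ∃ λ z → z ≢ y × Adj G x z
    other {x} {y} x~y with Fin.any? (λ z → ¬? (z Fin.≟ y) ×-dec adj? G x z)
    ... | yes z = z
    ... | no ¬z = contradiction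
      (x , y , x~y , λ z x~z → decidable-stable (z Fin.≟ y) λ z≢y → ¬z (z , z≢y , x~z)) ¬pendant
    start : ∃ (Adj G zero) → ∃ (TwoLinkedNeighbours G)
    start (y , e) = grow other (suc (suc n)) (e ∷ [-]) ((adj⇒≢ G e ∷ []) ∷ [] ∷ []) (ℕ.m≤m+n (suc (suc n)) 2)

-- Vertices on cycles

module _ {n} (G : Graph (suc n)) (x : Fin (suc n)) where

  private
    H : Graph n
    H = deleteᴳ G x

  -- An initial segment of a walk that avoids `x` survives the deletion of `x`. `connected-to-end`
  -- is the counterpart for final segments.
  connected-from-start : ∀ {m} (f : Fin (suc m) → Fin (suc n)) → (∀ i → Adj G (f (inject₁ i)) (f (suc i))) →
    ∀ j → (∀ l → l Fin.≤ j → x ≢ f l) → (p : x ≢ f zero) (q : x ≢ f j) → Connected H (punchOut p) (punchOut q)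
  connected-from-start f step zero avoid p q = subst (Connected H (punchOut p)) (Fin.punchOut-cong x refl) ε
  connected-from-start {suc m} f step (suc j) avoid p q =
    adj-punchOut G x p p′ (step zero) ◅
    connected-from-start (f ∘ suc) (step ∘ suc) j (λ l l≤j → avoid (suc l) (ℕ.s≤s l≤j)) p′ q
    where
    p′ : x ≢ f (suc zero)
    p′ = avoid (suc zero) (ℕ.s≤s ℕ.z≤n)

  connected-to-end : ∀ {m} (f : Fin (suc m) → Fin (suc n)) → (∀ i → Adj G (f (inject₁ i)) (f (suc i))) →
    ∀ j → (∀ l → j Fin.≤ l → x ≢ f l) → (p : x ≢ f j) (q : x ≢ f (fromℕ m)) → Connected H (punchOut p) (punchOut q)
  connected-to-end {zero} f step zero avoid p q = subst (Connected H (punchOut p)) (Fin.punchOut-cong x refl) ε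
  connected-to-end {suc m} f step zero avoid p q =
    adj-punchOut G x p p′ (step zero) ◅
    connected-to-end (f ∘ suc) (step ∘ suc) zero (λ l _ → avoid (suc l) ℕ.z≤n) p′ q
    where
    p′ : x ≢ f (suc zero)
    p′ = avoid (suc zero) ℕ.z≤n
  connected-to-end {suc m} f step (suc j) avoid p q =
    connected-to-end (f ∘ suc) (step ∘ suc) j (λ l j≤l → avoid (suc l) (ℕ.s≤s j≤l)) p q

module _ {n} (G : Graph (suc n)) (C : Cycle G) where

  open Cycle C renaming (vertex to f)

  -- The two cycle neighbours of `f i` are joined by the rest of the cycle. The closing edge is not
  -- a `step`, so the last, the first and the interior positions are separate cases.
  onCycle⇒twoLinkedNeighbours : ∀ i → TwoLinkedNeighbours G (f i)
  onCycle⇒twoLinkedNeighbours i with view i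
  ... | ‵fromℕ = twoLinkedNeighbours G (f i) (adj⇒≢ G close) (adj⇒≢ G prev) ((λ ()) ∘ distinct) close prev
      (connected-from-start G (f i) f step j before _ _)
    where
    j = inject₁ (fromℕ (suc k))
    before : ∀ l → l Fin.≤ j → f i ≢ f l
    before l l≤j eq = ℕ.<⇒≢ (ℕ.s≤s (ℕ.≤-trans l≤j (ℕ.≤-reflexive (Fin.toℕ-inject₁ _)))) (cong toℕ (≡.sym (distinct eq)))
    prev : Adj G (f i) (f j)
    prev = symm G (step (fromℕ (suc k)))
  ... | ‵inject₁ zero = twoLinkedNeighbours G (f zero) (adj⇒≢ G (step zero)) (adj⇒≢ G (symm G close)) ((λ ()) ∘ distinct)
      (step zero) (symm G close)
      (connected-to-end G (f zero) f step (suc zero) (λ { (suc l) _ eq → contradiction (distinct eq) λ () }) _ _)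
  ... | ‵inject₁ (suc j) = twoLinkedNeighbours G (f i) (adj⇒≢ G next) (adj⇒≢ G prev) (next≢prev ∘ distinct) next prev
      -- From the successor on to the last vertex, across the closing edge, then from vertex zero up
      -- to the predecessor.
      ( connected-to-end G (f i) f step (suc (suc j)) after _ i≢last
      ◅◅ adj-punchOut G (f i) i≢last i≢0 close
      ◅ connected-from-start G (f i) f step (inject₁ (inject₁ j)) before i≢0 _)
    where
    toℕ-i : toℕ i ≡ suc (toℕ j)
    toℕ-i = cong suc (Fin.toℕ-inject₁ j)
    off : ∀ {l} → toℕ l ≢ toℕ i → f i ≢ f l
    off l≢i eq = l≢i (cong toℕ (≡.sym (distinct eq)))
    after : ∀ l → suc (suc j) Fin.≤ l → f i ≢ f l
    after l j≤l = off (ℕ.>⇒≢ (ℕ.≤-trans (ℕ.s≤s (ℕ.≤-reflexive toℕ-i)) j≤l))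
    toℕ-prev : toℕ (inject₁ (inject₁ j)) ≡ toℕ j
    toℕ-prev = ≡.trans (Fin.toℕ-inject₁ (inject₁ j)) (Fin.toℕ-inject₁ j)
    before : ∀ l → l Fin.≤ inject₁ (inject₁ j) → f i ≢ f l
    before l l≤j = off
      (ℕ.<⇒≢ (ℕ.≤-trans (ℕ.s≤s (ℕ.≤-trans l≤j (ℕ.≤-reflexive toℕ-prev))) (ℕ.≤-reflexive (≡.sym toℕ-i))))
    next : Adj G (f i) (f (suc (suc j)))
    next = step (suc j)
    prev : Adj G (f i) (f (inject₁ (inject₁ j)))
    prev = symm G (step (inject₁ j))
    i≢last : f i ≢ f (fromℕ (2 ℕ.+ k))
    i≢last = after _ (Fin.≤fromℕ _)
    i≢0 : f i ≢ f zero
    i≢0 = before zero ℕ.z≤n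
    next≢prev : suc (suc j) ≢ inject₁ (inject₁ j)
    next≢prev eq = ℕ.>⇒≢ (ℕ.m<n⇒m<1+n (ℕ.n<1+n (toℕ j))) (≡.trans (cong toℕ eq) toℕ-prev)

  deleteCycle : ∀ u → (u∉C : ∀ i → u ≢ f i) → Cycle (deleteᴳ G u)
  deleteCycle u u∉C = record
    { vertex   = λ i → punchOut (u∉C i)
    ; distinct = λ {i} {j} → distinct ∘ Fin.punchOut-injective (u∉C i) (u∉C j)
    ; step     = λ i → adj-punchOut G u (u∉C (inject₁ i)) (u∉C (suc i)) (step i)
    ; close    = adj-punchOut G u (u∉C (fromℕ (2 ℕ.+ k))) (u∉C zero) close
    }

-- Subsets of Fin (suc n) with a distinguished element

punchIn-cases : ∀ {n} (P : Fin (suc n) → Set) (j : Fin (suc n)) →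
  P j → (∀ k → P (punchIn j k)) → ∀ l → P l
punchIn-cases P j Pj Pk l with j Fin.≟ l
... | yes refl = Pj
... | no j≢l = subst P (Fin.punchIn-punchOut j≢l) (Pk _)

-- Deleting `u` and then `v = punchIn u w` leaves the same numbering as deleting `v` first and then
-- `u`, by then renumbered to `u′`. `Pendant.≤-pendant` needs the second order for columns.
punchIn-exchange : ∀ {n} (u : Fin (suc (suc n))) (w : Fin (suc n)) → ∃ λ u′ →
  punchIn (punchIn u w) u′ ≡ u × (∀ k → punchIn (punchIn u w) (punchIn u′ k) ≡ punchIn u (punchIn w k))
punchIn-exchange         zero    w       = zero , refl , λ _ → refl
punchIn-exchange         (suc u) zero    = u , refl , λ _ → refl
punchIn-exchange {suc n} (suc u) (suc w) =
  let u′ , eq , exch = punchIn-exchange u w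
  in suc u′ , cong suc eq , λ { zero → refl ; (suc k) → cong suc (exch k) }

-- Matching on the view replaces a subset by its side at `j` and its restriction to the other
-- indices, the shape that deletion of a column requires.
data InsertView {n} (j : Fin (suc n)) : Subset (suc n) → Set where
  inserted : ∀ (s : Side) (S : Subset n) → InsertView j (insertAt S j s)

insertView : ∀ {n} (j : Fin (suc n)) S → InsertView j S
insertView j S = subst (InsertView j) (Vec.insertAt-removeAt S j) (inserted (lookupᵛ S j) (removeAt S j))

∣insert-outside∣ : ∀ {n} (S : Subset n) j → ∣ insertAt S j outside ∣ ≡ ∣ S ∣
∣insert-outside∣ S            zero    = refl
∣insert-outside∣ (true  ∷ S)  (suc j) = cong suc (∣insert-outside∣ S j)
∣insert-outside∣ (false ∷ S)  (suc j) = ∣insert-outside∣ S j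

∣insert-inside∣ : ∀ {n} (S : Subset n) j → ∣ insertAt S j inside ∣ ≡ suc ∣ S ∣
∣insert-inside∣ S            zero    = refl
∣insert-inside∣ (true  ∷ S)  (suc j) = cong suc (∣insert-inside∣ S j)
∣insert-inside∣ (false ∷ S)  (suc j) = ∣insert-inside∣ S j

∣insert∣≤ : ∀ {n} s (S : Subset n) j → ∣ insertAt S j s ∣ ℕ.≤ ∣ S ∣ ℕ.+ 1
∣insert∣≤ true  S j = ℕ.≤-reflexive (≡.trans (∣insert-inside∣ S j) (ℕ.+-comm 1 ∣ S ∣))
∣insert∣≤ false S j = ℕ.≤-trans (ℕ.≤-reflexive (∣insert-outside∣ S j)) (ℕ.m≤m+n ∣ S ∣ 1)

module _ {n} {S : Subset n} {j : Fin (suc n)} where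

  j∈insert : j ∈ insertAt S j inside
  j∈insert = Vec.lookup⇒[]= j _ (Vec.insertAt-lookup S j inside)

  j∉insert : j ∉ insertAt S j outside
  j∉insert j∈ = contradiction (≡.trans (≡.sym (Vec.insertAt-lookup S j outside)) (Vec.[]=⇒lookup j∈)) λ ()

  ∈-punchIn⁺ : ∀ {s k} → k ∈ S → punchIn j k ∈ insertAt S j s
  ∈-punchIn⁺ {s} {k} k∈ = Vec.lookup⇒[]= _ _ (≡.trans (Vec.insertAt-punchIn S j s k) (Vec.[]=⇒lookup k∈))

  ∈-punchIn⁻ : ∀ {s k} → punchIn j k ∈ insertAt S j s → k ∈ S
  ∈-punchIn⁻ {s} {k} k∈ =
    Vec.lookup⇒[]= _ _ (≡.trans (≡.sym (Vec.insertAt-punchIn S j s k)) (Vec.[]=⇒lookup k∈))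

-- Rank inequalities

-- The properties of ℂ on which the rank arguments rest: integrality with a negated hypothesis, and
-- stability to conclude by contradiction.
record StableDomain (K : CommutativeRing 0ℓ 0ℓ) : Set where
  open CommutativeRing K using (0#; 1#) renaming (_≈_ to _≈ᴷ_; _*_ to _*ᴷ_)
  field
    stable  : ∀ {x} → ¬ ¬ (x ≈ᴷ 0#) → x ≈ᴷ 0#
    cancel  : ∀ {x y} → ¬ x ≈ᴷ 0# → x *ᴷ y ≈ᴷ 0# → y ≈ᴷ 0#
    nonzero : ¬ 1# ≈ᴷ 0#

module Rank (K : CommutativeRing 0ℓ 0ℓ) (D : StableDomain K) where

  open StableDomain D
  open CommutativeRing K using (Carrier; 0#; 1#) renaming (_≈_ to _≈ᴷ_; _+_ to _+ᴷ_; _*_ to _*ᴷ_; -_ to -ᴷ_)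
  open CommutativeRing K hiding (Carrier; _≈_; _+_; _*_; -_; _-_; 0#; 1#; zero; refl)
  open import Algebra.Properties.Ring ring using (-‿distribˡ-*)
  open import Algebra.Properties.Semiring.Sum semiring
    using (sum; sum-cong-≋; sum-remove; ∑-distrib-+; *-distribˡ-sum; sum-replicate-zero)
  open import Relation.Binary.Reasoning.Setoid setoid

  Mat : ℕ → ℕ → Set
  Mat m n = Fin m → Fin n → Carrier

  -- For `K` = ℂ this unfolds to `ColumnsIndependent`, so that `rank-≤` can consume `IsRank`
  -- directly.
  Independent : ∀ {m n} → Mat m n → Subset n → Set
  Independent {m} {n} A S =
    (c : Fin n → Carrier) → (∀ j → j ∉ S → c j ≈ᴷ 0#) →
    (∀ i → sum (λ j → c j *ᴷ A i j) ≈ᴷ 0#) → ∀ j → c j ≈ᴷ 0#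

  -- rank A ≤ rank B + k, up to double negation
  record RankLe {m n m′ n′} (A : Mat m n) (B : Mat m′ n′) (k : ℤ) : Set where
    field
      transfer : ∀ S → Independent A S → ¬ ¬ ∃ λ T → Independent B T × + ∣ S ∣ ℤ.≤ + ∣ T ∣ ℤ.+ k
  open RankLe public

  rankLe-trans : ∀ {a b c d e f k l} {A : Mat a b} {B : Mat c d} {C : Mat e f} →
    RankLe A B k → RankLe B C l → RankLe A C (k ℤ.+ l)
  rankLe-trans {k = k} {l} A≤B B≤C .transfer S ind none =
    A≤B .transfer S ind λ (T , indT , S≤T) → B≤C .transfer T indT λ (U , indU , T≤U) →
      none (U , indU , ℤ.≤-trans S≤T (ℤ.≤-trans (ℤ.+-monoˡ-≤ k T≤U) (ℤ.≤-reflexive (rearrange (+ ∣ U ∣)))))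
    where
    rearrange : ∀ u → u ℤ.+ l ℤ.+ k ≡ u ℤ.+ (k ℤ.+ l)
    rearrange u = ≡.trans (ℤ.+-assoc u l k) (cong (λ m → u ℤ.+ m) (ℤ.+-comm l k))

  rankLe-weaken : ∀ {a b c d k l} {A : Mat a b} {B : Mat c d} →
    k ℤ.≤ l → RankLe A B k → RankLe A B l
  rankLe-weaken k≤l A≤B .transfer S ind none = A≤B .transfer S ind λ (T , indT , S≤T) →
    none (T , indT , ℤ.≤-trans S≤T (ℤ.+-monoʳ-≤ (+ ∣ T ∣) k≤l))

  +≤+0 : ∀ {a b} → a ℕ.≤ b → + a ℤ.≤ + b ℤ.+ + 0
  +≤+0 {b = b} a≤b = ℤ.+≤+ (ℕ.≤-trans a≤b (ℕ.m≤m+n b 0))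

  sum≈0 : ∀ {n} {f : Fin n → Carrier} → (∀ j → f j ≈ᴷ 0#) → sum f ≈ᴷ 0#
  sum≈0 {n} f≈0 = trans (sum-cong-≋ f≈0) (sum-replicate-zero n)

  x*0≈0 : ∀ {x y} → y ≈ᴷ 0# → x *ᴷ y ≈ᴷ 0#
  x*0≈0 {x} y≈0 = trans (*-congˡ y≈0) (zeroʳ x)

  0*x≈0 : ∀ {x y} → x ≈ᴷ 0# → x *ᴷ y ≈ᴷ 0#
  0*x≈0 {x} {y} x≈0 = trans (*-congʳ x≈0) (zeroˡ y)

  sum-remove-zero : ∀ {n} (j : Fin (suc n)) f → f j ≈ᴷ 0# → sum f ≈ᴷ sum (f ∘ punchIn j)
  sum-remove-zero j f fj≈0 = trans (sum-remove {i = j} f) (trans (+-congʳ fj≈0) (+-identityˡ _))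

  rankLe-cong : ∀ {m n} {A B : Mat m n} → (∀ i j → A i j ≈ᴷ B i j) → RankLe A B (+ 0)
  rankLe-cong A≈B .transfer S ind none = none
    ( S
    , (λ c supp rel → ind c supp λ i → trans (sum-cong-≋ λ j → *-congˡ (A≈B i j)) (rel i))
    , +≤+0 ℕ.≤-refl )

  dropColumn : ∀ {m n} → Fin (suc n) → Mat m (suc n) → Mat m n
  dropColumn j A i k = A i (punchIn j k)

  dropRow : ∀ {m n} → Fin (suc m) → Mat (suc m) n → Mat m n
  dropRow i A k = A (punchIn i k)

  module _ {m n} (A : Mat m (suc n)) (j : Fin (suc n)) where

    dropColumn-≤ : RankLe (dropColumn j A) A (+ 0)
    dropColumn-≤ .transfer S ind none = none
      ( insertAt S j outside
      , (λ c supp rel →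
          let cj≈0 = supp j j∉insert in
          punchIn-cases (λ l → c l ≈ᴷ 0#) j cj≈0
            (ind (c ∘ punchIn j) (λ k k∉ → supp (punchIn j k) (k∉ ∘ ∈-punchIn⁻))
              λ i → trans (sym (sum-remove-zero j (λ l → c l *ᴷ A i l) (0*x≈0 cj≈0))) (rel i)))
      , +≤+0 (ℕ.≤-reflexive (≡.sym (∣insert-outside∣ S j))) )

    independent-dropColumn : ∀ {s} S → Independent A (insertAt S j s) → Independent (dropColumn j A) S
    independent-dropColumn S ind c supp rel k =
      trans (reflexive (≡.sym (c′-punchIn k))) (ind c′ supp′ rel′ (punchIn j k))
      where
      -- A relation among the remaining columns is extended by zero at `j`.
      c′ = Vector.insertAt c j 0#
      c′-j : c′ j ≡ 0#
      c′-j = Vector.insertAt-lookup c j 0#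
      c′-punchIn : ∀ k → c′ (punchIn j k) ≡ c k
      c′-punchIn = Vector.insertAt-punchIn c j 0#
      supp′ : ∀ l → l ∉ insertAt S j _ → c′ l ≈ᴷ 0#
      supp′ = punchIn-cases _ j (λ _ → reflexive c′-j)
        (λ k k∉ → trans (reflexive (c′-punchIn k)) (supp k (k∉ ∘ ∈-punchIn⁺)))
      rel′ : ∀ i → sum (λ l → c′ l *ᴷ A i l) ≈ᴷ 0#
      rel′ i = trans (sum-remove-zero j (λ l → c′ l *ᴷ A i l) (0*x≈0 (reflexive c′-j)))
        (trans (sum-cong-≋ λ k → *-congʳ (reflexive (c′-punchIn k))) (rel i))

    ≤-dropColumn : RankLe A (dropColumn j A) (+ 1)
    ≤-dropColumn .transfer S ind none with insertView j S
    ... | inserted s S′ = none (S′ , independent-dropColumn S′ ind , ℤ.+≤+ (∣insert∣≤ s S′ j))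

    ≤-dropColumn-zero : (∀ i → A i j ≈ᴷ 0#) → RankLe A (dropColumn j A) (+ 0)
    ≤-dropColumn-zero Aj≈0 .transfer S ind none with insertView j S
    ... | inserted false S′ =
      none (S′ , independent-dropColumn S′ ind , +≤+0 (ℕ.≤-reflexive (∣insert-outside∣ S′ j)))
    -- A zero column cannot belong to an independent set: the unit vector at `j` would be a
    -- relation, forcing 1 = 0.
    ... | inserted true S′ = nonzero (trans (reflexive (≡.sym e-j)) (ind e supp rel j))
      where
      e : Fin (suc n) → Carrier
      e = Vector.insertAt (λ _ → 0#) j 1#
      e-j : e j ≡ 1#
      e-j = Vector.insertAt-lookup _ j 1#
      e-punchIn : ∀ k → e (punchIn j k) ≡ 0#
      e-punchIn = Vector.insertAt-punchIn _ j 1#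
      supp : ∀ l → l ∉ insertAt S′ j inside → e l ≈ᴷ 0#
      supp = punchIn-cases _ j (contradiction j∈insert) λ k _ → reflexive (e-punchIn k)
      rel : ∀ i → sum (λ l → e l *ᴷ A i l) ≈ᴷ 0#
      rel i = sum≈0 {f = λ l → e l *ᴷ A i l} (punchIn-cases _ j (x*0≈0 (Aj≈0 i)) λ k → 0*x≈0 (reflexive (e-punchIn k)))

  module _ {m n} (A : Mat (suc m) n) (i : Fin (suc m)) where

    dropRow-≤ : RankLe (dropRow i A) A (+ 0)
    dropRow-≤ .transfer S ind none = none
      (S , (λ c supp rel → ind c supp (rel ∘ punchIn i)) , +≤+0 ℕ.≤-refl)

    ≤-dropRow-zero : (∀ j → A i j ≈ᴷ 0#) → RankLe A (dropRow i A) (+ 0)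
    ≤-dropRow-zero Ai≈0 .transfer S ind none = none
      ( S
      , (λ c supp rel → ind c supp (punchIn-cases _ i (sum≈0 λ j → x*0≈0 (Ai≈0 j)) rel))
      , +≤+0 ℕ.≤-refl )

  sum-combination : ∀ {n} a b (c d f : Fin n → Carrier) →
    sum (λ j → (a *ᴷ c j +ᴷ b *ᴷ d j) *ᴷ f j) ≈ᴷ a *ᴷ sum (λ j → c j *ᴷ f j) +ᴷ b *ᴷ sum (λ j → d j *ᴷ f j)
  sum-combination a b c d f = begin
    sum (λ j → (a *ᴷ c j +ᴷ b *ᴷ d j) *ᴷ f j)
      ≈⟨ sum-cong-≋ (λ j → trans (distribʳ (f j) (a *ᴷ c j) (b *ᴷ d j))
                                 (+-cong (*-assoc a (c j) (f j)) (*-assoc b (d j) (f j)))) ⟩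
    sum (λ j → a *ᴷ (c j *ᴷ f j) +ᴷ b *ᴷ (d j *ᴷ f j))
      ≈⟨ ∑-distrib-+ (λ j → a *ᴷ (c j *ᴷ f j)) (λ j → b *ᴷ (d j *ᴷ f j)) ⟩
    sum (λ j → a *ᴷ (c j *ᴷ f j)) +ᴷ sum (λ j → b *ᴷ (d j *ᴷ f j))
      ≈⟨ +-cong (*-distribˡ-sum a (λ j → c j *ᴷ f j)) (*-distribˡ-sum b (λ j → d j *ᴷ f j)) ⟨
    a *ᴷ sum (λ j → c j *ᴷ f j) +ᴷ b *ᴷ sum (λ j → d j *ᴷ f j) ∎

  -- If c is a relation among the columns S once row i is dropped, and c j ≠ 0, then any relation d
  -- on S ∖ j is combined with c into one that also holds in row i, hence vanishes.
  ≤-dropRow : ∀ {m n} (A : Mat (suc m) n) i → RankLe A (dropRow i A) (+ 1)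
  ≤-dropRow {n = zero} A i .transfer S ind none = none (S , (λ _ _ _ ()) , ℤ.+≤+ (ℕ.m≤m+n ∣ S ∣ 1))
  ≤-dropRow {n = suc n} A i .transfer S ind none = none (S , independent , ℤ.+≤+ (ℕ.m≤m+n ∣ S ∣ 1))
    where
    independent : Independent (dropRow i A) S
    -- `none` is refuted with `S` itself; should a coefficient `c j` be non-zero, it is refuted
    -- instead with `j` removed from `S`.
    independent c supp rel j = stable λ cj≉0 → exchange cj≉0 (insertView j S) ind supp none
      where
      exchange : ¬ c j ≈ᴷ 0# → ∀ {S} → InsertView j S → Independent A S → (∀ l → l ∉ S → c l ≈ᴷ 0#) →
        ¬ ¬ ∃ λ T → Independent (dropRow i A) T × + ∣ S ∣ ℤ.≤ + ∣ T ∣ ℤ.+ + 1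
      exchange cj≉0 (inserted s S′) ind supp none =
        none (T , indT , ℤ.+≤+ (ℕ.≤-trans (∣insert∣≤ s S′ j)
          (ℕ.+-monoˡ-≤ 1 (ℕ.≤-reflexive (≡.sym (∣insert-outside∣ S′ j))))))
        where
        T : Subset (suc n)
        T = insertAt S′ j outside
        α : Carrier
        -- The defect of `c` in row `i`. It is non-zero, as otherwise `c` would be a relation of `A`
        -- on `S`.
        α = sum (λ l → c l *ᴷ A i l)
        α≉0 : ¬ α ≈ᴷ 0#
        α≉0 α≈0 = cj≉0 (ind c supp (punchIn-cases _ i α≈0 rel) j)
        indT : Independent (dropRow i A) T
        indT d suppT relT l = cancel α≉0 (begin
          α *ᴷ d l                  ≈⟨ +-identityʳ _ ⟨
          α *ᴷ d l +ᴷ 0#             ≈⟨ +-congˡ (0*x≈0 -β≈0) ⟨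
          α *ᴷ d l +ᴷ (-ᴷ β) *ᴷ c l    ≈⟨ e≈0 l ⟩
          0#                       ∎)
          where
          β : Carrier
          β = sum (λ l → d l *ᴷ A i l)
          dj≈0 : d j ≈ᴷ 0#
          dj≈0 = suppT j j∉insert
          e≈0 : ∀ l → α *ᴷ d l +ᴷ (-ᴷ β) *ᴷ c l ≈ᴷ 0#
          -- In row `i` this combination gives α β - β α = 0. Its coefficient at `j`, where `d`
          -- vanishes and `c` does not, then yields β = 0.
          e≈0 = ind (λ l → α *ᴷ d l +ᴷ (-ᴷ β) *ᴷ c l)
            (λ l l∉S → trans
              (+-cong (x*0≈0 (punchIn-cases (λ l → l ∉ insertAt S′ j s → d l ≈ᴷ 0#) j (λ _ → dj≈0)
                         (λ k k∉ → suppT (punchIn j k) (k∉ ∘ ∈-punchIn⁺ ∘ ∈-punchIn⁻)) l l∉S))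
                      (x*0≈0 (supp l l∉S)))
              (+-identityˡ 0#))
            (punchIn-cases _ i
              (begin
                _                    ≈⟨ sum-combination α (-ᴷ β) d c (A i) ⟩
                α *ᴷ β +ᴷ (-ᴷ β) *ᴷ α    ≈⟨ +-congˡ (-‿distribˡ-* β α) ⟨
                α *ᴷ β +ᴷ -ᴷ (β *ᴷ α)    ≈⟨ +-congˡ (-‿cong (*-comm β α)) ⟩
                α *ᴷ β +ᴷ -ᴷ (α *ᴷ β)    ≈⟨ -‿inverseʳ _ ⟩
                0#                   ∎)
              λ k → trans (sum-combination α (-ᴷ β) d c (A (punchIn i k)))
                      (trans (+-cong (x*0≈0 (relT k)) (x*0≈0 (rel k))) (+-identityˡ 0#)))
          -β≈0 : -ᴷ β ≈ᴷ 0#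
          -β≈0 = cancel cj≉0 (begin
            c j *ᴷ (-ᴷ β)              ≈⟨ *-comm (c j) (-ᴷ β) ⟩
            (-ᴷ β) *ᴷ c j              ≈⟨ +-identityˡ _ ⟨
            0# +ᴷ (-ᴷ β) *ᴷ c j         ≈⟨ +-congʳ (x*0≈0 dj≈0) ⟨
            α *ᴷ d j +ᴷ (-ᴷ β) *ᴷ c j    ≈⟨ e≈0 j ⟩
            0#                       ∎)

  -- Principal minors and elimination of a pendant pair

  minor : ∀ {n} → Fin (suc n) → Mat (suc n) (suc n) → Mat n n
  minor u A i j = A (punchIn u i) (punchIn u j)

  minor-≤ : ∀ {n} (A : Mat (suc n) (suc n)) u → RankLe (minor u A) A (+ 0)
  minor-≤ A u = rankLe-trans (dropRow-≤ (dropColumn u A) u) (dropColumn-≤ A u)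

  ≤-minor : ∀ {n} (A : Mat (suc n) (suc n)) u → RankLe A (minor u A) (+ 2)
  ≤-minor A u = rankLe-trans (≤-dropColumn A u) (≤-dropRow (dropColumn u A) u)

  ≤-minor-zero : ∀ {n} (A : Mat (suc n) (suc n)) u →
    (∀ j → A u j ≈ᴷ 0#) → (∀ i → A i u ≈ᴷ 0#) → RankLe A (minor u A) (+ 0)
  ≤-minor-zero A u row col =
    rankLe-trans (≤-dropColumn-zero A u col) (≤-dropRow-zero (dropColumn u A) u (row ∘ punchIn u))

  -- Row and column `u` vanish except possibly at `v = punchIn u w`, and `B` is what remains after
  -- both indices are deleted.
  module Pendant {n} (A : Mat (suc (suc n)) (suc (suc n))) (u : Fin (suc (suc n))) (w : Fin (suc n))
    (row : ∀ k → A u (punchIn u (punchIn w k)) ≈ᴷ 0#)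
    (col : ∀ k → A (punchIn u (punchIn w k)) u ≈ᴷ 0#)
    (Auu≈0 : A u u ≈ᴷ 0#) where

    private
      v : Fin (suc (suc n))
      v = punchIn u w
      B : Mat n n
      B = minor w (minor u A)

    -- Without column v the row of u vanishes, and without row v the column of u does.
    ≤-pendant : RankLe A B (+ 2)
    ≤-pendant =
      rankLe-trans {B = A₁} (≤-dropColumn A v)
      (rankLe-trans {B = A₂} (≤-dropRow-zero A₁ u row₁)
      (rankLe-trans {B = A₃} (≤-dropRow A₂ w)
      (rankLe-trans {B = A₄} (≤-dropColumn-zero A₃ u′ col₃) (rankLe-cong λ i k → reflexive (cong (A _) (swap k))))))
      where
      u′ : Fin (suc n)
      u′ = proj₁ (punchIn-exchange u w)
      vu′ : punchIn v u′ ≡ u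
      vu′ = proj₁ (proj₂ (punchIn-exchange u w))
      swap : ∀ k → punchIn v (punchIn u′ k) ≡ punchIn u (punchIn w k)
      swap = proj₂ (proj₂ (punchIn-exchange u w))
      A₁ = dropColumn v A
      A₂ = dropRow u A₁
      A₃ = dropRow w A₂
      A₄ = dropColumn u′ A₃
      row₁ : ∀ k → A₁ u k ≈ᴷ 0#
      row₁ = punchIn-cases _ u′ (trans (reflexive (cong (A u) vu′)) Auu≈0)
        λ k → trans (reflexive (cong (A u) (swap k))) (row k)
      col₃ : ∀ k → A₃ k u′ ≈ᴷ 0#
      col₃ k = trans (reflexive (cong (A _) vu′)) (col k)

    -- Adding `u` and `v` to an independent set of `B` keeps it independent: row `u` gives `c v` =
    -- 0, then the rows of `B` kill the coefficients on `S`, and finally row `v` gives `c u` = 0.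
    pendant-≤ : ¬ A u v ≈ᴷ 0# → ¬ A v u ≈ᴷ 0# → RankLe B A (ℤ.- + 2)
    pendant-≤ Auv≉0 Avu≉0 .transfer S ind none = none (T , indT , size)
      where
      T = insertAt (insertAt S w inside) u inside
      size : + ∣ S ∣ ℤ.≤ + ∣ T ∣ ℤ.- + 2
      size = ℤ.≤-reflexive (≡.sym (cong (λ x → + x ℤ.- + 2)
        (≡.trans (∣insert-inside∣ _ u) (cong suc (∣insert-inside∣ S w)))))
      indT : Independent A T
      indT c supp rel = punchIn-cases _ u cu≈0 (punchIn-cases _ w cv≈0 ck≈0)
        where
        ι : Fin n → Fin (suc (suc n))
        ι k = punchIn u (punchIn w k)
        expand : ∀ i → c u *ᴷ A i u +ᴷ (c v *ᴷ A i v +ᴷ sum (λ k → c (ι k) *ᴷ A i (ι k))) ≈ᴷ 0#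
        expand i = trans (+-congˡ (sym (sum-remove {i = w} (λ k → c (punchIn u k) *ᴷ A i (punchIn u k)))))
          (trans (sym (sum-remove {i = u} (λ l → c l *ᴷ A i l))) (rel i))
        cv≈0 : c v ≈ᴷ 0#
        cv≈0 = cancel Auv≉0 (begin
          A u v *ᴷ c v  ≈⟨ *-comm _ _ ⟩
          c v *ᴷ A u v  ≈⟨ trans (+-congˡ (sum≈0 λ k → x*0≈0 (row k))) (+-identityʳ _) ⟨
          _            ≈⟨ trans (+-congʳ (x*0≈0 Auu≈0)) (+-identityˡ _) ⟨
          _            ≈⟨ expand u ⟩
          0#           ∎)
        ck≈0 : ∀ k → c (ι k) ≈ᴷ 0#
        ck≈0 = ind _ (λ k k∉ → supp _ (k∉ ∘ ∈-punchIn⁻ ∘ ∈-punchIn⁻)) λ i → begin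
          _   ≈⟨ trans (+-congʳ (0*x≈0 cv≈0)) (+-identityˡ _) ⟨
          _   ≈⟨ trans (+-congʳ (x*0≈0 (col i))) (+-identityˡ _) ⟨
          _   ≈⟨ expand (ι i) ⟩
          0#  ∎
        cu≈0 : c u ≈ᴷ 0#
        cu≈0 = cancel Avu≉0 (begin
          A v u *ᴷ c u  ≈⟨ *-comm _ _ ⟩
          c u *ᴷ A v u  ≈⟨ trans (+-congˡ rest≈0) (+-identityʳ _) ⟨
          _            ≈⟨ expand v ⟩
          0#           ∎)
          where
          rest≈0 : c v *ᴷ A v v +ᴷ sum (λ k → c (ι k) *ᴷ A v (ι k)) ≈ᴷ 0#
          rest≈0 = trans (+-cong (0*x≈0 cv≈0) (sum≈0 λ k → 0*x≈0 (ck≈0 k))) (+-identityˡ 0#)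

  -- The only property of a gain matrix that the rank bounds use.
  HasPattern : ∀ {n} → Graph n → Mat n n → Set
  HasPattern G A = (∀ i j → Adj G i j → ¬ A i j ≈ᴷ 0#) × (∀ i j → ¬ Adj G i j → A i j ≈ᴷ 0#)

  minor-pattern : ∀ {n} (G : Graph (suc n)) {A} u → HasPattern G A → HasPattern (deleteᴳ G u) (minor u A)
  minor-pattern G u (edge , nonedge) =
    (λ i j → edge (punchIn u i) (punchIn u j)) , λ i j → nonedge (punchIn u i) (punchIn u j)

  module PendantPattern {n} {G : Graph (suc (suc n))} {A} (pat : HasPattern G A)
    u w (only : OnlyNeighbour G u (punchIn u w)) where

    private
      nonadjacent : ∀ k → ¬ Adj G u (punchIn u (punchIn w k))
      nonadjacent k e = Fin.punchInᵢ≢i w k (Fin.punchIn-injective u _ _ (proj₂ only _ e))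
      module P = Pendant A u w
        (λ k → proj₂ pat _ _ (nonadjacent k))
        (λ k → proj₂ pat _ _ (nonadjacent k ∘ symm G))
        (proj₂ pat _ _ (irrefl G))

    ≤-pendant : RankLe A (minor w (minor u A)) (+ 2)
    ≤-pendant = P.≤-pendant

    pendant-≤ : RankLe (minor w (minor u A)) A (ℤ.- + 2)
    pendant-≤ = P.pendant-≤ (proj₁ pat _ _ (proj₁ only)) (proj₁ pat _ _ (symm G (proj₁ only)))

  -- The rank bound, by induction on the graph

  double-mono : ∀ {s t} → s ℤ.≤ t → + 2 * s ℤ.≤ + 2 * t
  double-mono = ℤ.*-monoˡ-≤-nonNeg (+ 2)

  -- Both matrices are arbitrary with pattern `G`: minors stay in the class, and exchanging `A` and
  -- `B` gives the bound from below.
  RankBound : ℕ → Set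
  RankBound n = (G : Graph n) (A B : Mat n n) → HasPattern G A → HasPattern G B → RankLe A B (+ 2 * θ G)

  -- The induction is strong because the pendant case removes two vertices at once.
  rank-bound : ∀ n → RankBound n
  rank-bound = <-rec RankBound step
    where
    step : ∀ n → (∀ {m} → m ℕ.< n → RankBound m) → RankBound n
    step zero _ G A B _ _ .transfer [] _ none = none ([] , (λ _ _ _ ()) , ℤ.≤-refl)
    step (suc n) rec G A B patA patB with trichotomy G
    ... | inj₁ (x , isolated) =
      rankLe-weaken (ℤ.≤-trans (ℤ.≤-reflexive (zeros (+ 2 * θ (deleteᴳ G x)))) (double-mono (θ-delete-≤ G x)))
        (rankLe-trans (≤-minor-zero A x (λ j → proj₂ patA _ _ (isolated j))
                                        (λ i → proj₂ patA _ _ (isolated i ∘ symm G)))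
        (rankLe-trans (rec ℕ.≤-refl (deleteᴳ G x) (minor x A) (minor x B) (minor-pattern G x patA) (minor-pattern G x patB))
          (minor-≤ B x)))
      where
      zeros : ∀ t → + 0 + (t + + 0) ≡ t
      zeros t = ≡.trans (ℤ.+-identityˡ _) (ℤ.+-identityʳ t)
    ... | inj₂ (inj₂ (x , linked)) =
      -- Passing from `A` to its minor costs at most 2, which is paid for by the drop of `θ` by at
      -- least 1; returning from the minor of `B` to `B` costs nothing.
      rankLe-weaken (ℤ.≤-trans (ℤ.≤-reflexive (two (θ (deleteᴳ G x)))) (double-mono (θ-delete-< G x linked)))
        (rankLe-trans (≤-minor A x)
        (rankLe-trans (rec ℕ.≤-refl (deleteᴳ G x) (minor x A) (minor x B) (minor-pattern G x patA) (minor-pattern G x patB))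
          (minor-≤ B x)))
      where
      two : ∀ t → + 2 + (+ 2 * t + + 0) ≡ + 2 * (t + + 1)
      two = solve 1 (λ t → con (+ 2) :+ (con (+ 2) :* t :+ con (+ 0)) := con (+ 2) :* (t :+ con (+ 1))) refl
        where open ℤ.+-*-Solver
    ... | inj₂ (inj₁ (u , v , only)) = pendant n rec G A B patA patB (punchOut u≢v)
          (subst (OnlyNeighbour G u) (≡.sym (Fin.punchIn-punchOut u≢v)) only)
      where
      u≢v : u ≢ v
      u≢v = adj⇒≢ G (proj₁ only)
      -- Generalised over `n` so that it can be matched: the index `w : Fin n` leaves only the
      -- successor case, in which a second vertex can be deleted.
      pendant : ∀ n → (∀ {m} → m ℕ.< suc n → RankBound m) → (G : Graph (suc n)) (A B : Mat (suc n) (suc n)) →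
        HasPattern G A → HasPattern G B → ∀ {u} w → OnlyNeighbour G u (punchIn u w) → RankLe A B (+ 2 * θ G)
      pendant (suc n) rec G A B patA patB {u} w only =
        rankLe-weaken
          (ℤ.≤-trans (ℤ.≤-reflexive (twos (+ 2 * θ F)))
            (double-mono (ℤ.≤-trans (θ-delete-≤ (deleteᴳ G u) w) (θ-delete-≤ G u))))
          (rankLe-trans (PendantPattern.≤-pendant {G = G} patA u w only)
          (rankLe-trans
            (rec (ℕ.m<n⇒m<1+n ℕ.≤-refl) F _ _
              (minor-pattern (deleteᴳ G u) w (minor-pattern G u patA))
              (minor-pattern (deleteᴳ G u) w (minor-pattern G u patB)))
            (PendantPattern.pendant-≤ {G = G} {A = B} patB u w only)))
        where
        F = deleteᴳ (deleteᴳ G u) w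
        -- The 2 lost by `A` is regained exactly by `B`.
        twos : ∀ t → + 2 + (t - + 2) ≡ t
        twos = solve 1 (λ t → con (+ 2) :+ (t :- con (+ 2)) := t) refl
          where open ℤ.+-*-Solver

-- Ranks of gain matrices and adjacency matrices

ℂ-stableDomain : StableDomain ℂ-commutativeRing
ℂ-stableDomain = record
  { stable  = λ {z} → ≈0-stable {z}
  ; cancel  = λ {z} {w} → *ℂ-cancel {z} {w}
  ; nonzero = 1ℂ≉0ℂ
  }

open Rank ℂ-commutativeRing ℂ-stableDomain

-- Here the double negation disappears, since the order on ℤ is decidable.
rank-≤ : ∀ {m n m′ n′} {A : Matrix m n} {B : Matrix m′ n′} {r s k} →
  RankLe A B k → IsRank A r → IsRank B s → + r ℤ.≤ + s + k
rank-≤ {s = s} {k} A≤B ((S , ind , refl) , _) (_ , maximal) = decidable-stable (_ ℤ.≤? _) λ ¬≤ →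
  A≤B .transfer S ind λ (T , indT , S≤T) →
    ¬≤ (ℤ.≤-trans S≤T (ℤ.+-monoˡ-≤ k (ℤ.+≤+ (maximal T indT))))

gainMatrix-pattern : ∀ {n} (Φ : GainGraph n) → HasPattern (graph Φ) (gainMatrix Φ)
gainMatrix-pattern Φ = edge , nonedge
  where
  edge : ∀ i j → Adj (graph Φ) i j → ¬ gainMatrix Φ i j ≈ 0ℂ
  edge i j e with adj? (graph Φ) i j
  ... | yes e′ = unit≉0 {GainGraph.gain Φ i j e′} (GainGraph.unit Φ i j e′)
  ... | no ¬e = contradiction e ¬e
  nonedge : ∀ i j → ¬ Adj (graph Φ) i j → gainMatrix Φ i j ≈ 0ℂ
  nonedge i j ¬e with adj? (graph Φ) i j
  ... | yes e = contradiction e ¬e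
  ... | no _ = CommutativeRing.refl ℂ-commutativeRing {0ℂ}

adjacencyMatrix-pattern : ∀ {n} (G : Graph n) → HasPattern G (adjacencyMatrix G)
adjacencyMatrix-pattern G = edge , nonedge
  where
  edge : ∀ i j → Adj G i j → ¬ adjacencyMatrix G i j ≈ 0ℂ
  edge i j e with adj? G i j
  ... | yes _ = 1ℂ≉0ℂ
  ... | no ¬e = contradiction e ¬e
  nonedge : ∀ i j → ¬ Adj G i j → adjacencyMatrix G i j ≈ 0ℂ
  nonedge i j ¬e with adj? G i j
  ... | yes e = contradiction e ¬e
  ... | no _ = CommutativeRing.refl ℂ-commutativeRing {0ℂ}

gainMatrix-delete : ∀ {n} (Φ : GainGraph (suc n)) u i j →
  gainMatrix (delete Φ u) i j ≡ minor u (gainMatrix Φ) i j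
gainMatrix-delete Φ u i j with adj? (graph Φ) (punchIn u i) (punchIn u j)
... | yes _ = refl
... | no  _ = refl

adjacencyMatrix-delete : ∀ {n} (G : Graph (suc n)) u i j →
  adjacencyMatrix (deleteᴳ G u) i j ≡ minor u (adjacencyMatrix G) i j
adjacencyMatrix-delete G u i j with adj? G (punchIn u i) (punchIn u j)
... | yes _ = refl
... | no  _ = refl

-- The two pendant inequalities are combined by antisymmetry. `B` is tied to the minor entry by
-- entry, which is how the matrix of a deleted graph is identified with it.
pendant-rank : ∀ {n} {G : Graph (suc (suc n))} {A B} → HasPattern G A → ∀ u w → OnlyNeighbour G u (punchIn u w) →
  (∀ i j → B i j ≡ minor w (minor u A) i j) → ∀ {r s} → IsRank A r → IsRank B s → + s ≡ + r - + 2
pendant-rank {G = G} {A} {B} pat u w only B≡ {r} {s} rankA rankB = ℤ.≤-antisym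
  (rank-≤ (rankLe-trans {A = B} (rankLe-cong λ i j → ≡⇒≈ (B≡ i j))
            (PendantPattern.pendant-≤ {G = G} {A = A} pat u w only)) rankB rankA)
  (subst (+ r - + 2 ℤ.≤_) (cancel-2 (+ s)) (ℤ.+-monoˡ-≤ (ℤ.- + 2)
    (rank-≤ (rankLe-trans {A = A} (PendantPattern.≤-pendant {G = G} {A = A} pat u w only)
              (rankLe-cong λ i j → ≡⇒≈ (≡.sym (B≡ i j)))) rankA rankB)))
  where
  ≡⇒≈ : ∀ {z z′} → z ≡ z′ → z ≈ z′
  ≡⇒≈ {z} refl = CommutativeRing.refl ℂ-commutativeRing {z}
  cancel-2 : ∀ s → s + + 2 - + 2 ≡ s
  cancel-2 = solve 1 (λ s → s :+ con (+ 2) :- con (+ 2) := s) refl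
    where open ℤ.+-*-Solver

-- The pendant vertex and the extremal case

pendant⇒onlyNeighbour : ∀ {n} (G : Graph (suc n)) {u v} → Pendant G u → Adj G u v → OnlyNeighbour G u v
pendant⇒onlyNeighbour G {u} deg u~v = u~v , λ z u~z → same deg (∈-neighbours⁺ G u~z) (∈-neighbours⁺ G u~v)
  where
  same : ∀ {A : Set} {xs : List A} {y z} → length xs ≡ 1 → z ∈ˡ xs → y ∈ˡ xs → z ≡ y
  same {xs = _ ∷ []} _ (here refl) (here refl) = refl

-- A vertex on a cycle has two distinct neighbours.
pendant∉cycle : ∀ {n} (G : Graph (suc n)) {u v} → OnlyNeighbour G u v → (C : Cycle G) → ∀ i → u ≢ Cycle.vertex C i
pendant∉cycle G (_ , only) C i refl with onCycle⇒twoLinkedNeighbours G C i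
... | j , k , j≢k , u~j , u~k , _ =
  j≢k (Fin.punchIn-injective _ j k (≡.trans (only _ u~j) (≡.sym (only _ u~k))))

module _ {n} (G : Graph (suc (suc n))) {u v : Fin (suc (suc n))} (u≢v : u ≢ v) where

  θ-deletePair-≤ : θ (deletePairᴳ G u v u≢v) ℤ.≤ θ G
  θ-deletePair-≤ = ℤ.≤-trans (θ-delete-≤ (deleteᴳ G u) (punchOut u≢v)) (θ-delete-≤ G u)

  -- The cycle avoids `u`, so it survives in `G` - `u`, where deleting `v` lowers `θ` strictly.
  θ-deletePair-< : (C : Cycle G) → (∀ i → u ≢ Cycle.vertex C i) → LiesOn G v C →
    θ (deletePairᴳ G u v u≢v) + + 1 ℤ.≤ θ G
  θ-deletePair-< C u∉C (i , eq) = ℤ.≤-trans (θ-delete-< (deleteᴳ G u) (punchOut u≢v) linked) (θ-delete-≤ G u)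
    where
    linked : TwoLinkedNeighbours (deleteᴳ G u) (punchOut u≢v)
    linked = subst (TwoLinkedNeighbours (deleteᴳ G u)) (Fin.punchOut-cong u eq)
      (onCycle⇒twoLinkedNeighbours (deleteᴳ G u) (deleteCycle G C u u∉C) i)

-- With t = `θ G` and s = `θ F`, this turns the rank bound for `F` into θ(G) ≤ θ(F).
extremal : ∀ {a b s t} → a ≡ b + + 2 * t → a ℤ.≤ b + + 2 * s → t ℤ.≤ s
extremal {b = b} refl a≤ = ℤ.≮⇒≥ λ s<t → ℤ.<⇒≱ (ℤ.+-monoʳ-< b (ℤ.*-monoˡ-<-pos (+ 2) s<t)) a≤

theorem4p2 :
    ∀ {n : ℕ} (Φ : GainGraph (suc (suc n))) (u v : Fin (suc (suc n))) →
    Pendant (graph Φ) u → (u~v : Adj (graph Φ) u v) →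
    let G  = graph Φ
        Fᵠ = deletePair Φ u v (adj⇒≢ G u~v)
        F  = deletePairᴳ G u v (adj⇒≢ G u~v)
    in ∀ (rΦ rG rFᵠ rF : ℕ) →
       IsRank (gainMatrix Φ) rΦ → IsRank (adjacencyMatrix G) rG →
       IsRank (gainMatrix Fᵠ) rFᵠ → IsRank (adjacencyMatrix F) rF →
       ( + rΦ ≡ + rG + + 2 * θ G →
         (∀ (C : Cycle G) → ¬ LiesOn G v C) × + rFᵠ ≡ + rF + + 2 * θ F )
       ×
       ( + rΦ ≡ + rG - + 2 * θ G →
         (∀ (C : Cycle G) → ¬ LiesOn G v C) × + rFᵠ ≡ + rF - + 2 * θ F )
theorem4p2 {n} Φ u v pendant u~v rΦ rG rFᵠ rF isΦ isG isFᵠ isF = upper , lower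
  where
  open ≡.≡-Reasoning
  G : Graph (suc (suc n))
  G = graph Φ
  u≢v : u ≢ v
  u≢v = adj⇒≢ G u~v
  F : Graph n
  F = deletePairᴳ G u v u≢v
  Fᵠ : GainGraph n
  Fᵠ = deletePair Φ u v u≢v
  w : Fin (suc n)
  w = punchOut u≢v
  only : OnlyNeighbour G u v
  only = pendant⇒onlyNeighbour G pendant u~v
  only′ : OnlyNeighbour G u (punchIn u w)
  only′ = subst (OnlyNeighbour G u) (≡.sym (Fin.punchIn-punchOut u≢v)) only

  rFᵠ≡ : + rFᵠ ≡ + rΦ - + 2
  rFᵠ≡ = pendant-rank {G = G} {A = gainMatrix Φ} {B = gainMatrix Fᵠ} (gainMatrix-pattern Φ) u w only′
    (λ i j → ≡.trans (gainMatrix-delete (delete Φ u) w i j)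
      (gainMatrix-delete Φ u (punchIn w i) (punchIn w j))) isΦ isFᵠ
  rF≡ : + rF ≡ + rG - + 2
  rF≡ = pendant-rank {G = G} {A = adjacencyMatrix G} {B = adjacencyMatrix F} (adjacencyMatrix-pattern G) u w only′
    (λ i j → ≡.trans (adjacencyMatrix-delete (deleteᴳ G u) w i j)
      (adjacencyMatrix-delete G u (punchIn w i) (punchIn w j))) isG isF

  -- A cycle through `v` would make θ(F) strictly smaller than θ(G), against the hypothesis.
  conclude : θ G ℤ.≤ θ F → (∀ (C : Cycle G) → ¬ LiesOn G v C) × θ G ≡ θ F
  conclude G≤F =
    (λ C v∈C → ℤ.<-irrefl refl (ℤ.suc[i]≤j⇒i<j (subst (ℤ._≤ θ F) (ℤ.+-comm (θ F) (+ 1))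
      (ℤ.≤-trans (θ-deletePair-< G u≢v C (pendant∉cycle G only C) v∈C) G≤F)))) ,
    ℤ.≤-antisym G≤F (θ-deletePair-≤ G u≢v)

  upper : + rΦ ≡ + rG + + 2 * θ G → (∀ (C : Cycle G) → ¬ LiesOn G v C) × + rFᵠ ≡ + rF + + 2 * θ F
  upper eq = proj₁ end , subst (λ t → + rFᵠ ≡ + rF + + 2 * t) (proj₂ end) eqF
    where
    eqF : + rFᵠ ≡ + rF + + 2 * θ G
    eqF = begin
      + rFᵠ                      ≡⟨ rFᵠ≡ ⟩
      + rΦ - + 2                 ≡⟨ cong (_- + 2) eq ⟩
      + rG + + 2 * θ G - + 2
        ≡⟨ solve 2 (λ r t → r :+ t :- con (+ 2) := r :- con (+ 2) :+ t) refl (+ rG) (+ 2 * θ G) ⟩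
      + rG - + 2 + + 2 * θ G     ≡⟨ cong (_+ + 2 * θ G) rF≡ ⟨
      + rF + + 2 * θ G           ∎
      where open ℤ.+-*-Solver
    end = conclude (extremal {b = + rF} eqF
      (rank-≤ (rank-bound n F (gainMatrix Fᵠ) (adjacencyMatrix F) (gainMatrix-pattern Fᵠ) (adjacencyMatrix-pattern F)) isFᵠ isF))

  lower : + rΦ ≡ + rG - + 2 * θ G → (∀ (C : Cycle G) → ¬ LiesOn G v C) × + rFᵠ ≡ + rF - + 2 * θ F
  lower eq = proj₁ end , subst (λ t → + rFᵠ ≡ + rF - + 2 * t) (proj₂ end) eqF
    where
    eqF : + rFᵠ ≡ + rF - + 2 * θ G
    eqF = begin
      + rFᵠ                      ≡⟨ rFᵠ≡ ⟩
      + rΦ - + 2                 ≡⟨ cong (_- + 2) eq ⟩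
      + rG - + 2 * θ G - + 2
        ≡⟨ solve 2 (λ r t → r :- t :- con (+ 2) := r :- con (+ 2) :- t) refl (+ rG) (+ 2 * θ G) ⟩
      + rG - + 2 - + 2 * θ G     ≡⟨ cong (_- + 2 * θ G) rF≡ ⟨
      + rF - + 2 * θ G           ∎
      where open ℤ.+-*-Solver
    -- Solved for r(F), so that the rank bound applies with the adjacency matrix first and the gain
    -- matrix second.
    eqF′ : + rF ≡ + rFᵠ + + 2 * θ G
    eqF′ = begin
      + rF                                 ≡⟨ solve 2 (λ r t → r := r :- t :+ t) refl (+ rF) (+ 2 * θ G) ⟩
      + rF - + 2 * θ G + + 2 * θ G         ≡⟨ cong (_+ + 2 * θ G) eqF ⟨
      + rFᵠ + + 2 * θ G                    ∎
      where open ℤ.+-*-Solver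
    end = conclude (extremal {b = + rFᵠ} eqF′
      (rank-≤ (rank-bound n F (adjacencyMatrix F) (gainMatrix Fᵠ) (adjacencyMatrix-pattern F) (gainMatrix-pattern Fᵠ)) isF isFᵠ))
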